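{- Let $n\ge1$, $m,m'\ge0$. The subring of $S_n$-invariants of $\mathbb{C}[X_{n\times m};\Theta_{n\times m'}]$ is generated as a $\mathbb{C}$-algebra by the power sum generators $p_S$, where $S$ runs over all multisets over $[m]\cup[\overline{m'}]$ with no repeated barred entries and $|S|\le n$.
   Context: $\mathbb{C}[X_{n\times m};\Theta_{n\times m'}]$ is the associative $\mathbb{C}$-algebra generated by $x_{rk}$ ($1\le r\le n$, $1\le k\le m$) and $\theta_{ri}$ ($1\le r\le n$, $1\le i\le m'$) with: the $x_{rk}$ commute with each other and with all $\theta_{si}$; $\theta_{ri}\theta_{sj}=-\theta_{sj}\theta_{ri}$ for $(r,i)\ne(s,j)$; $\theta_{ri}^2=0$. $S_n$ acts by algebra automorphisms via $\sigma(x_{rk})=x_{\sigma(r)k}$, $\sigma(\theta_{ri})=\theta_{\sigma(r)i}$. Multisets are over $\{1,\dots,m\}\cup\{\bar1,\dots,\overline{m'}\}$ (entries $\bar j$ barred). For $S=\{\!\{1^{a_1},\dots,m^{a_m},\bar s_1,\dots,\bar s_k\}\!\}$ with $s_1<\dots<s_k$ distinct, $|S|=a_1+\dots+a_m+k$ and $p_S=\sum_{r=1}^n x_{r1}^{a_1}\cdots x_{rm}^{a_m}\theta_{rs_1}\cdots\theta_{rs_k}$ (so $p_\emptyset=n$). -}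

module Defs where

open import Algebra.Bundles using (Semiring; Ring; CommutativeRing)
import Algebra.Definitions.RawMonoid as RawMonoidDefinitions
import Algebra.Definitions.RawSemiring as RawSemiringDefinitions
import Algebra.Properties.Ring as RingProperties
import Algebra.Solver.Ring.NaturalCoefficients.Default as Solver
open import Data.Fin.Base using (Fin)
open import Data.Fin.Permutation using (Permutation′; _⟨$⟩ʳ_; _⟨$⟩ˡ_; inverseˡ)
open import Data.Nat.Base as ℕ using (ℕ)
import Data.Nat.Properties as ℕ
open import Data.Product.Base using (_,_; _×_; ∃-syntax; proj₁; proj₂)
open import Data.Product.Properties using (,-injective)
open import Data.Rational.Base as ℚ using (ℚ; 0ℚ; 1ℚ; ½; ∣_∣)
import Data.Rational.Properties as ℚ
import Data.Rational.Solver as ℚ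
open import Data.Sum.Base using (_⊎_; inj₁; inj₂)
open import Level using (Level; 0ℓ; _⊔_)
open import Relation.Binary.PropositionalEquality as ≡ using (_≡_; _≢_)
open import Relation.Unary using (Pred)

-- A real number is a Cauchy sequence of rationals, up to null sequences.
module Real where

  infix 4 _~_

  -- For Cauchy sequences this is the usual |sᵢ - tᵢ| → 0.  With two
  -- indices, s ~ s says that s is a Cauchy sequence.
  record _~_ (s t : ℕ → ℚ) : Set where
    constructor mk~
    field
      modulus : ∀ ε → 0ℚ ℚ.< ε →
                ∃[ N ] (∀ i j → N ℕ.≤ i → N ℕ.≤ j → ∣ s i ℚ.- t j ∣ ℚ.≤ ε)

  open _~_ public

  record ℝ : Set where
    constructor mkℝ
    field
      seq    : ℕ → ℚ
      cauchy : seq ~ seq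

  open ℝ public

  infix 4 _≈_

  record _≈_ (x y : ℝ) : Set where
    constructor mk≈
    field
      close : seq x ~ seq y

  open _≈_ public

  private
    module S = ℚ.+-*-Solver

    ½+½ : ∀ ε → ½ ℚ.* ε ℚ.+ ½ ℚ.* ε ≡ ε
    ½+½ ε = ≡.trans (≡.sym (ℚ.*-distribʳ-+ ε ½ ½)) (ℚ.*-identityˡ ε)

    0<½ε : ∀ {ε} → 0ℚ ℚ.< ε → 0ℚ ℚ.< ½ ℚ.* ε
    0<½ε {ε} 0<ε = ℚ.positive⁻¹ (½ ℚ.* ε) {{ℚ.pos*pos⇒pos ½ ε {{ℚ.positive 0<ε}}}}

    ∣∣-triangle : ∀ {p q r a b} → r ≡ p ℚ.+ q → ∣ p ∣ ℚ.≤ a → ∣ q ∣ ℚ.≤ b →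
                  ∣ r ∣ ℚ.≤ a ℚ.+ b
    ∣∣-triangle {p} {q} ≡.refl h k =
      ℚ.≤-trans (ℚ.∣p+q∣≤∣p∣+∣q∣ p q) (ℚ.+-mono-≤ h k)

    ∣∣-product : ∀ p q {a b} → ∣ p ∣ ℚ.≤ a → ∣ q ∣ ℚ.≤ b → ∣ p ℚ.* q ∣ ℚ.≤ a ℚ.* b
    ∣∣-product p q {a} {b} h k = begin
      ∣ p ℚ.* q ∣      ≡⟨ ℚ.∣p*q∣≡∣p∣*∣q∣ p q ⟩
      ∣ p ∣ ℚ.* ∣ q ∣  ≤⟨ ℚ.*-monoˡ-≤-nonNeg ∣ p ∣ {{ℚ.∣-∣-nonNeg p}} k ⟩
      ∣ p ∣ ℚ.* b      ≤⟨ ℚ.*-monoʳ-≤-nonNeg b {{ℚ.nonNegative (ℚ.≤-trans (ℚ.0≤∣p∣ q) k)}} h ⟩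
      a ℚ.* b          ∎
      where open ℚ.≤-Reasoning

  ~-pointwise : ∀ {s t} → s ~ s → (∀ i → s i ≡ t i) → s ~ t
  ~-pointwise {s} s~s s≗t = mk~ λ ε 0<ε →
    let N , h = modulus s~s ε 0<ε in
    N , λ i j p q → ≡.subst (λ u → ∣ s i ℚ.- u ∣ ℚ.≤ ε) (s≗t j) (h i j p q)

  ~-sym : ∀ {s t} → s ~ t → t ~ s
  ~-sym {s} {t} s~t = mk~ λ ε 0<ε →
    let N , h = modulus s~t ε 0<ε in
    N , λ i j p q → ≡.subst (ℚ._≤ ε) (flip (s j) (t i)) (h j i q p)
    where
    flip : ∀ a b → ∣ a ℚ.- b ∣ ≡ ∣ b ℚ.- a ∣
    flip a b = ≡.trans (≡.sym (ℚ.∣-p∣≡∣p∣ (a ℚ.- b)))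
      (≡.cong ∣_∣ (S.solve 2 (λ a b → S.:- (a S.:- b) S.:= b S.:- a) ≡.refl a b))

  ~-trans : ∀ {s t u} → s ~ t → t ~ u → s ~ u
  ~-trans {s} {t} {u} s~t t~u = mk~ λ ε 0<ε →
    let N , h = modulus s~t (½ ℚ.* ε) (0<½ε 0<ε)
        M , k = modulus t~u (½ ℚ.* ε) (0<½ε 0<ε)
        L = N ℕ.⊔ M
    in L , λ i j p q → ≡.subst (∣ s i ℚ.- u j ∣ ℚ.≤_) (½+½ ε)
      (∣∣-triangle (telescope (s i) (t L) (u j))
        (h i L (ℕ.≤-trans (ℕ.m≤m⊔n N M) p) (ℕ.m≤m⊔n N M))
        (k L j (ℕ.m≤n⊔m N M) (ℕ.≤-trans (ℕ.m≤n⊔m N M) q)))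
    where
    telescope : ∀ a b c → a ℚ.- c ≡ (a ℚ.- b) ℚ.+ (b ℚ.- c)
    telescope = S.solve 3 (λ a b c → a S.:- c S.:= (a S.:- b) S.:+ (b S.:- c)) ≡.refl

  ~-const : ∀ c → (λ _ → c) ~ (λ _ → c)
  ~-const c = mk~ λ ε 0<ε → 0 , λ _ _ _ _ →
    ≡.subst (λ z → ∣ z ∣ ℚ.≤ ε) (≡.sym (ℚ.+-inverseʳ c)) (ℚ.<⇒≤ 0<ε)

  ~-+ : ∀ {s s′ t t′} → s ~ s′ → t ~ t′ →
        (λ i → s i ℚ.+ t i) ~ (λ i → s′ i ℚ.+ t′ i)
  ~-+ {s} {s′} {t} {t′} s~s′ t~t′ = mk~ λ ε 0<ε →
    let N , h = modulus s~s′ (½ ℚ.* ε) (0<½ε 0<ε)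
        M , k = modulus t~t′ (½ ℚ.* ε) (0<½ε 0<ε)
    in N ℕ.⊔ M , λ i j p q →
      ≡.subst (∣ (s i ℚ.+ t i) ℚ.- (s′ j ℚ.+ t′ j) ∣ ℚ.≤_) (½+½ ε)
      (∣∣-triangle (regroup (s i) (t i) (s′ j) (t′ j))
        (h i j (ℕ.≤-trans (ℕ.m≤m⊔n N M) p) (ℕ.≤-trans (ℕ.m≤m⊔n N M) q))
        (k i j (ℕ.≤-trans (ℕ.m≤n⊔m N M) p) (ℕ.≤-trans (ℕ.m≤n⊔m N M) q)))
    where
    regroup : ∀ a b c d → (a ℚ.+ b) ℚ.- (c ℚ.+ d) ≡ (a ℚ.- c) ℚ.+ (b ℚ.- d)
    regroup = S.solve 4 (λ a b c d →
      (a S.:+ b) S.:- (c S.:+ d) S.:= (a S.:- c) S.:+ (b S.:- d)) ≡.refl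

  ~-neg : ∀ {s t} → s ~ t → (λ i → ℚ.- s i) ~ (λ i → ℚ.- t i)
  ~-neg {s} {t} s~t = mk~ λ ε 0<ε →
    let N , h = modulus s~t ε 0<ε in
    N , λ i j p q → ≡.subst (ℚ._≤ ε) (negate (s i) (t j)) (h i j p q)
    where
    negate : ∀ a b → ∣ a ℚ.- b ∣ ≡ ∣ ℚ.- a ℚ.- ℚ.- b ∣
    negate a b = ≡.trans (≡.sym (ℚ.∣-p∣≡∣p∣ (a ℚ.- b)))
      (≡.cong ∣_∣ (S.solve 2 (λ a b → S.:- (a S.:- b) S.:= S.:- a S.:- S.:- b) ≡.refl a b))

  private
    eventuallyBounded : ∀ {s} → s ~ s →
      ∃[ B ] (0ℚ ℚ.< B × ∃[ N ] (∀ i → N ℕ.≤ i → ∣ s i ∣ ℚ.≤ B))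
    eventuallyBounded {s} s~s =
      let N , h = modulus s~s 1ℚ (ℚ.positive⁻¹ 1ℚ) in
      1ℚ ℚ.+ ∣ s N ∣ ,
      ℚ.positive⁻¹ (1ℚ ℚ.+ ∣ s N ∣) {{ℚ.pos+nonNeg⇒pos 1ℚ ∣ s N ∣ {{ℚ.∣-∣-nonNeg (s N)}}}} ,
      N , λ i p → ∣∣-triangle (cancel (s i) (s N)) (h i N p ℕ.≤-refl) ℚ.≤-refl
      where
      cancel : ∀ a b → a ≡ (a ℚ.- b) ℚ.+ b
      cancel = S.solve 2 (λ a b → a S.:= (a S.:- b) S.:+ b) ≡.refl

    divide : ∀ B ε → 0ℚ ℚ.< B → 0ℚ ℚ.< ε → ∃[ δ ] (0ℚ ℚ.< δ × B ℚ.* δ ≡ ε)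
    divide B ε 0<B 0<ε = ℚ.1/ B ℚ.* ε
      , ℚ.positive⁻¹ (ℚ.1/ B ℚ.* ε) {{ℚ.pos*pos⇒pos (ℚ.1/ B) ε}}
      , ≡.trans (≡.sym (ℚ.*-assoc B (ℚ.1/ B) ε))
          (≡.trans (≡.cong (ℚ._* ε) (ℚ.*-inverseʳ B)) (ℚ.*-identityˡ ε))
      where
      instance
        B-pos = ℚ.positive 0<B
        ε-pos = ℚ.positive 0<ε
        B-nonZero = ℚ.pos⇒nonZero B
        1/B-pos = ℚ.1/pos⇒pos B

  ~-* : ∀ {s s′ t t′} → s ~ s → t′ ~ t′ → s ~ s′ → t ~ t′ →
        (λ i → s i ℚ.* t i) ~ (λ i → s′ i ℚ.* t′ i)
  ~-* {s} {s′} {t} {t′} s~s t′~t′ s~s′ t~t′ = mk~ λ ε 0<ε →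
    let A , 0<A , N₁ , a = eventuallyBounded s~s
        B , 0<B , N₂ , b = eventuallyBounded t′~t′
        δ , 0<δ , [A+B]δ≡ε = divide (A ℚ.+ B) ε (ℚ.+-mono-< 0<A 0<B) 0<ε
        N₃ , h = modulus s~s′ δ 0<δ
        N₄ , k = modulus t~t′ δ 0<δ
        N₁₂ = N₁ ℕ.⊔ N₂
        N₃₄ = N₃ ℕ.⊔ N₄
        l : N₁₂ ℕ.≤ N₁₂ ℕ.⊔ N₃₄
        l = ℕ.m≤m⊔n N₁₂ N₃₄
        r : N₃₄ ℕ.≤ N₁₂ ℕ.⊔ N₃₄
        r = ℕ.m≤n⊔m N₁₂ N₃₄
        n₁ = ℕ.≤-trans (ℕ.m≤m⊔n N₁ N₂) l
        n₂ = ℕ.≤-trans (ℕ.m≤n⊔m N₁ N₂) l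
        n₃ = ℕ.≤-trans (ℕ.m≤m⊔n N₃ N₄) r
        n₄ = ℕ.≤-trans (ℕ.m≤n⊔m N₃ N₄) r
    in N₁₂ ℕ.⊔ N₃₄ , λ i j p q →
      ≡.subst (∣ s i ℚ.* t i ℚ.- s′ j ℚ.* t′ j ∣ ℚ.≤_)
        (≡.trans (factor A B δ) [A+B]δ≡ε)
        (∣∣-triangle (regroup (s i) (t i) (s′ j) (t′ j))
          (∣∣-product (s i) (t i ℚ.- t′ j) (a i (ℕ.≤-trans n₁ p)) (k i j (ℕ.≤-trans n₄ p) (ℕ.≤-trans n₄ q)))
          (∣∣-product (s i ℚ.- s′ j) (t′ j) (h i j (ℕ.≤-trans n₃ p) (ℕ.≤-trans n₃ q)) (b j (ℕ.≤-trans n₂ q))))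
    where
    regroup : ∀ a b c d → a ℚ.* b ℚ.- c ℚ.* d ≡ a ℚ.* (b ℚ.- d) ℚ.+ (a ℚ.- c) ℚ.* d
    regroup = S.solve 4 (λ a b c d → a S.:* b S.:- c S.:* d S.:=
      a S.:* (b S.:- d) S.:+ (a S.:- c) S.:* d) ≡.refl
    factor : ∀ A B δ → A ℚ.* δ ℚ.+ δ ℚ.* B ≡ (A ℚ.+ B) ℚ.* δ
    factor = S.solve 3 (λ A B δ → A S.:* δ S.:+ δ S.:* B S.:= (A S.:+ B) S.:* δ) ≡.refl

  infixl 6 _+_
  infixl 7 _*_
  infix  8 -_

  fromℚ : ℚ → ℝ
  fromℚ q = mkℝ (λ _ → q) (~-const q)

  _+_ : ℝ → ℝ → ℝ
  x + y = mkℝ (λ i → seq x i ℚ.+ seq y i) (~-+ (cauchy x) (cauchy y))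

  -_ : ℝ → ℝ
  - x = mkℝ (λ i → ℚ.- seq x i) (~-neg (cauchy x))

  _*_ : ℝ → ℝ → ℝ
  x * y = mkℝ (λ i → seq x i ℚ.* seq y i)
              (~-* (cauchy x) (cauchy y) (cauchy x) (cauchy y))

  pointwise : ∀ {x y} → (∀ i → seq x i ≡ seq y i) → x ≈ y
  pointwise {x} h = mk≈ (~-pointwise (cauchy x) h)

  ℝ-commutativeRing : CommutativeRing 0ℓ 0ℓ
  ℝ-commutativeRing = record
    { Carrier = ℝ
    ; _≈_ = _≈_
    ; _+_ = _+_
    ; _*_ = _*_
    ; -_ = -_
    ; 0# = fromℚ 0ℚ
    ; 1# = fromℚ 1ℚ
    ; isCommutativeRing = record
      { isRing = record
        { +-isAbelianGroup = record
          { isGroup = record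
            { isMonoid = record
              { isSemigroup = record
                { isMagma = record
                  { isEquivalence = record
                    { refl = λ {x} → mk≈ (cauchy x)
                    ; sym = λ x≈y → mk≈ (~-sym (close x≈y))
                    ; trans = λ x≈y y≈z → mk≈ (~-trans (close x≈y) (close y≈z))
                    }
                  ; ∙-cong = λ x≈y u≈v → mk≈ (~-+ (close x≈y) (close u≈v))
                  }
                ; assoc = λ x y z → pointwise λ i → ℚ.+-assoc (seq x i) (seq y i) (seq z i)
                }
              ; identity = (λ x → pointwise λ i → ℚ.+-identityˡ (seq x i))
                         , (λ x → pointwise λ i → ℚ.+-identityʳ (seq x i))
              }
            ; inverse = (λ x → pointwise λ i → ℚ.+-inverseˡ (seq x i))
                      , (λ x → pointwise λ i → ℚ.+-inverseʳ (seq x i))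
            ; ⁻¹-cong = λ x≈y → mk≈ (~-neg (close x≈y))
            }
          ; comm = λ x y → pointwise λ i → ℚ.+-comm (seq x i) (seq y i)
          }
        ; *-cong = λ {x} {y} {u} {v} x≈y u≈v →
            mk≈ (~-* (cauchy x) (cauchy v) (close x≈y) (close u≈v))
        ; *-assoc = λ x y z → pointwise λ i → ℚ.*-assoc (seq x i) (seq y i) (seq z i)
        ; *-identity = (λ x → pointwise λ i → ℚ.*-identityˡ (seq x i))
                     , (λ x → pointwise λ i → ℚ.*-identityʳ (seq x i))
        ; distrib = (λ x y z → pointwise λ i → ℚ.*-distribˡ-+ (seq x i) (seq y i) (seq z i))
                  , (λ x y z → pointwise λ i → ℚ.*-distribʳ-+ (seq x i) (seq y i) (seq z i))
        }
      ; *-comm = λ x y → pointwise λ i → ℚ.*-comm (seq x i) (seq y i)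
      }
    }

module Complexification {c ℓ} (R : CommutativeRing c ℓ) where

  private
    module R = CommutativeRing R
    module S = Solver R.commutativeSemiring
    open S using (_:=_; _:+_; _:*_)

  record Complex : Set c where
    constructor _+i_
    field
      re im : R.Carrier

  open Complex public

  infix 4 _≈_
  infixl 6 _+_
  infixl 7 _*_

  record _≈_ (z w : Complex) : Set ℓ where
    constructor mk≈
    field
      re≈ : re z R.≈ re w
      im≈ : im z R.≈ im w

  open _≈_ public

  _+_ : Complex → Complex → Complex
  (a +i b) + (a′ +i b′) = (a R.+ a′) +i (b R.+ b′)

  -_ : Complex → Complex
  - (a +i b) = (R.- a) +i (R.- b)

  _*_ : Complex → Complex → Complex
  (a +i b) * (a′ +i b′) =
    (a R.* a′ R.+ R.- (b R.* b′)) +i (a R.* b′ R.+ b R.* a′)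

  commutativeRing : CommutativeRing c ℓ
  commutativeRing = record
    { Carrier = Complex
    ; _≈_ = _≈_
    ; _+_ = _+_
    ; _*_ = _*_
    ; -_ = -_
    ; 0# = R.0# +i R.0#
    ; 1# = R.1# +i R.0#
    ; isCommutativeRing = record
      { isRing = record
        { +-isAbelianGroup = record
          { isGroup = record
            { isMonoid = record
              { isSemigroup = record
                { isMagma = record
                  { isEquivalence = record
                    { refl = mk≈ R.refl R.refl
                    ; sym = λ p → mk≈ (R.sym (re≈ p)) (R.sym (im≈ p))
                    ; trans = λ p q → mk≈ (R.trans (re≈ p) (re≈ q)) (R.trans (im≈ p) (im≈ q))
                    }
                  ; ∙-cong = λ p q → mk≈ (R.+-cong (re≈ p) (re≈ q)) (R.+-cong (im≈ p) (im≈ q))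
                  }
                ; assoc = λ x y z → mk≈ (R.+-assoc (re x) (re y) (re z)) (R.+-assoc (im x) (im y) (im z))
                }
              ; identity = (λ x → mk≈ (R.+-identityˡ (re x)) (R.+-identityˡ (im x)))
                         , (λ x → mk≈ (R.+-identityʳ (re x)) (R.+-identityʳ (im x)))
              }
            ; inverse = (λ x → mk≈ (R.-‿inverseˡ (re x)) (R.-‿inverseˡ (im x)))
                      , (λ x → mk≈ (R.-‿inverseʳ (re x)) (R.-‿inverseʳ (im x)))
            ; ⁻¹-cong = λ p → mk≈ (R.-‿cong (re≈ p)) (R.-‿cong (im≈ p))
            }
          ; comm = λ x y → mk≈ (R.+-comm (re x) (re y)) (R.+-comm (im x) (im y))
          }
        ; *-cong = *-cong
        ; *-assoc = *-assoc
        ; *-identity = *-identityˡ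
                     , (λ x → trans (*-comm x _) (*-identityˡ x))
        ; distrib = distribˡ
                  , (λ x y z → trans (*-comm (y + z) x)
                      (trans (distribˡ x y z) (+-cong (*-comm x y) (*-comm x z))))
        }
      ; *-comm = *-comm
      }
    }
    where
    trans : ∀ {x y z} → x ≈ y → y ≈ z → x ≈ z
    trans p q = mk≈ (R.trans (re≈ p) (re≈ q)) (R.trans (im≈ p) (im≈ q))

    +-cong : ∀ {x y u v} → x ≈ y → u ≈ v → x + u ≈ y + v
    +-cong p q = mk≈ (R.+-cong (re≈ p) (re≈ q)) (R.+-cong (im≈ p) (im≈ q))

    *-cong : ∀ {x y u v} → x ≈ y → u ≈ v → x * u ≈ y * v
    *-cong p q = mk≈
      (R.+-cong (R.*-cong (re≈ p) (re≈ q)) (R.-‿cong (R.*-cong (im≈ p) (im≈ q))))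
      (R.+-cong (R.*-cong (re≈ p) (im≈ q)) (R.*-cong (im≈ p) (re≈ q)))

    -‿as-* : ∀ a → R.- a R.≈ R.- R.1# R.* a
    -‿as-* a = R.sym (RingProperties.-1*x≈-x R.ring a)

    *-comm : ∀ x y → x * y ≈ y * x
    *-comm (a +i b) (c +i d) = mk≈
      (R.+-cong (R.*-comm a c) (R.-‿cong (R.*-comm b d)))
      (S.solve 4 (λ a b c d → a :* d :+ b :* c := c :* b :+ d :* a) R.refl a b c d)

    *-assoc : ∀ x y z → (x * y) * z ≈ x * (y * z)
    *-assoc (a +i b) (c +i d) (e +i f) = mk≈
      (R.trans (R.+-cong (R.*-congʳ (R.+-congˡ (-‿as-* _))) (-‿as-* _))
        (R.trans (S.solve 7 (λ ε a b c d e f →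
            (a :* c :+ ε :* (b :* d)) :* e :+ ε :* ((a :* d :+ b :* c) :* f)
            := a :* (c :* e :+ ε :* (d :* f)) :+ ε :* (b :* (c :* f :+ d :* e)))
          R.refl (R.- R.1#) a b c d e f)
        (R.sym (R.+-cong (R.*-congˡ (R.+-congˡ (-‿as-* _))) (-‿as-* _)))))
      (R.trans (R.+-congʳ (R.*-congʳ (R.+-congˡ (-‿as-* _))))
        (R.trans (S.solve 7 (λ ε a b c d e f →
            (a :* c :+ ε :* (b :* d)) :* f :+ (a :* d :+ b :* c) :* e
            := a :* (c :* f :+ d :* e) :+ b :* (c :* e :+ ε :* (d :* f)))
          R.refl (R.- R.1#) a b c d e f)
        (R.sym (R.+-congˡ (R.*-congˡ (R.+-congˡ (-‿as-* _)))))))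

    *-identityˡ : ∀ x → (R.1# +i R.0#) * x ≈ x
    *-identityˡ (a +i b) = mk≈
      (R.trans (R.+-cong (R.*-identityˡ a)
          (R.trans (R.-‿cong (R.zeroˡ b)) (RingProperties.-0#≈0# R.ring)))
        (R.+-identityʳ a))
      (R.trans (R.+-cong (R.*-identityˡ b) (R.zeroˡ a)) (R.+-identityʳ b))

    distribˡ : ∀ x y z → x * (y + z) ≈ x * y + x * z
    distribˡ (a +i b) (c +i d) (e +i f) = mk≈
      (R.trans (R.+-congˡ (-‿as-* _))
        (R.trans (S.solve 7 (λ ε a b c d e f →
            a :* (c :+ e) :+ ε :* (b :* (d :+ f))
            := (a :* c :+ ε :* (b :* d)) :+ (a :* e :+ ε :* (b :* f)))
          R.refl (R.- R.1#) a b c d e f)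
        (R.sym (R.+-cong (R.+-congˡ (-‿as-* _)) (R.+-congˡ (-‿as-* _))))))
      (S.solve 6 (λ a b c d e f →
          a :* (d :+ f) :+ b :* (c :+ e) := (a :* d :+ b :* c) :+ (a :* f :+ b :* e))
        R.refl a b c d e f)

ℂ : CommutativeRing 0ℓ 0ℓ
ℂ = Complexification.commutativeRing Real.ℝ-commutativeRing

-- A multiset over [m] ∪ [m̄′], given by its multiplicity function.
Multiset : ℕ → ℕ → Set
Multiset m m′ = Fin m ⊎ Fin m′ → ℕ

pattern barred j = inj₂ j
pattern plain k = inj₁ k

NoRepeatedBarred : ∀ {m m′} → Multiset m m′ → Set
NoRepeatedBarred S = ∀ j → S (barred j) ℕ.≤ 1

size : ∀ {m m′} → Multiset m m′ → ℕ
size S = Σℕ (λ k → S (plain k)) ℕ.+ Σℕ (λ j → S (barred j))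
  where open RawMonoidDefinitions ℕ.+-0-rawMonoid renaming (sum to Σℕ)

module SuperPolynomials {c ℓ} (K : CommutativeRing c ℓ) (n m m′ : ℕ) where

  private
    module K = CommutativeRing K

  infix  4 _≈_
  infixl 6 _+_
  infixl 7 _*_
  infix  8 -_

  data Carrier : Set c where
    const : K.Carrier → Carrier
    x     : Fin n → Fin m → Carrier
    θ     : Fin n → Fin m′ → Carrier
    _+_   : Carrier → Carrier → Carrier
    _*_   : Carrier → Carrier → Carrier
    -_    : Carrier → Carrier

  -- The least congruence making Carrier an associative unital K-algebra,
  -- with structure map const, that satisfies the last four relations.
  data _≈_ : Carrier → Carrier → Set (c ⊔ ℓ) where
    refl  : ∀ {f} → f ≈ f
    sym   : ∀ {f g} → f ≈ g → g ≈ f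
    trans : ∀ {f g h} → f ≈ g → g ≈ h → f ≈ h

    +-cong : ∀ {f f′ g g′} → f ≈ f′ → g ≈ g′ → f + g ≈ f′ + g′
    *-cong : ∀ {f f′ g g′} → f ≈ f′ → g ≈ g′ → f * g ≈ f′ * g′
    -‿cong : ∀ {f g} → f ≈ g → - f ≈ - g

    +-assoc     : ∀ f g h → (f + g) + h ≈ f + (g + h)
    +-comm      : ∀ f g → f + g ≈ g + f
    +-identityˡ : ∀ f → const K.0# + f ≈ f
    -‿inverseˡ  : ∀ f → - f + f ≈ const K.0#
    *-assoc     : ∀ f g h → (f * g) * h ≈ f * (g * h)
    *-identityˡ : ∀ f → const K.1# * f ≈ f
    *-identityʳ : ∀ f → f * const K.1# ≈ f
    distribˡ    : ∀ f g h → f * (g + h) ≈ f * g + f * h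
    distribʳ    : ∀ f g h → (g + h) * f ≈ g * f + h * f

    const-cong    : ∀ {a b} → a K.≈ b → const a ≈ const b
    const-+       : ∀ a b → const (a K.+ b) ≈ const a + const b
    const-*       : ∀ a b → const (a K.* b) ≈ const a * const b
    const-central : ∀ a f → const a * f ≈ f * const a

    x-x-commute : ∀ r k s l → x r k * x s l ≈ x s l * x r k
    x-θ-commute : ∀ r k s i → x r k * θ s i ≈ θ s i * x r k
    θ-θ-anticommute : ∀ r i s j → (r , i) ≢ (s , j) → θ r i * θ s j ≈ - (θ s j * θ r i)
    θ-square : ∀ r i → θ r i * θ r i ≈ const K.0#

  ring : Ring c (c ⊔ ℓ)
  ring = record
    { Carrier = Carrier
    ; _≈_ = _≈_
    ; _+_ = _+_
    ; _*_ = _*_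
    ; -_ = -_
    ; 0# = const K.0#
    ; 1# = const K.1#
    ; isRing = record
      { +-isAbelianGroup = record
        { isGroup = record
          { isMonoid = record
            { isSemigroup = record
              { isMagma = record
                { isEquivalence = record { refl = refl ; sym = sym ; trans = trans }
                ; ∙-cong = +-cong
                }
              ; assoc = +-assoc
              }
            ; identity = +-identityˡ , λ f → trans (+-comm f _) (+-identityˡ f)
            }
          ; inverse = -‿inverseˡ , λ f → trans (+-comm f _) (-‿inverseˡ f)
          ; ⁻¹-cong = -‿cong
          }
        ; comm = +-comm
        }
      ; *-cong = *-cong
      ; *-assoc = *-assoc
      ; *-identity = *-identityˡ , *-identityʳ
      ; distrib = distribˡ , distribʳ
      }
    }

  -- product f = f 0 * (f 1 * …): the factors appear in increasing order.
  open RawSemiringDefinitions (Semiring.rawSemiring (Ring.semiring ring)) public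
    using (sum; product; _^_)

  act : Permutation′ n → Carrier → Carrier
  act σ (const a) = const a
  act σ (x r k)   = x (σ ⟨$⟩ʳ r) k
  act σ (θ r i)   = θ (σ ⟨$⟩ʳ r) i
  act σ (f + g)   = act σ f + act σ g
  act σ (f * g)   = act σ f * act σ g
  act σ (- f)     = - act σ f

  act-cong : ∀ σ {f g} → f ≈ g → act σ f ≈ act σ g
  act-cong σ refl = refl
  act-cong σ (sym p) = sym (act-cong σ p)
  act-cong σ (trans p q) = trans (act-cong σ p) (act-cong σ q)
  act-cong σ (+-cong p q) = +-cong (act-cong σ p) (act-cong σ q)
  act-cong σ (*-cong p q) = *-cong (act-cong σ p) (act-cong σ q)
  act-cong σ (-‿cong p) = -‿cong (act-cong σ p)
  act-cong σ (+-assoc f g h) = +-assoc _ _ _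
  act-cong σ (+-comm f g) = +-comm _ _
  act-cong σ (+-identityˡ f) = +-identityˡ _
  act-cong σ (-‿inverseˡ f) = -‿inverseˡ _
  act-cong σ (*-assoc f g h) = *-assoc _ _ _
  act-cong σ (*-identityˡ f) = *-identityˡ _
  act-cong σ (*-identityʳ f) = *-identityʳ _
  act-cong σ (distribˡ f g h) = distribˡ _ _ _
  act-cong σ (distribʳ f g h) = distribʳ _ _ _
  act-cong σ (const-cong p) = const-cong p
  act-cong σ (const-+ a b) = const-+ a b
  act-cong σ (const-* a b) = const-* a b
  act-cong σ (const-central a f) = const-central a _
  act-cong σ (x-x-commute r k s l) = x-x-commute _ k _ l
  act-cong σ (x-θ-commute r k s i) = x-θ-commute _ k _ i
  act-cong σ (θ-θ-anticommute r i s j ri≢sj) =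
    θ-θ-anticommute _ i _ j λ eq →
      let σr≡σs , i≡j = ,-injective eq in
      ri≢sj (≡.cong₂ _,_
        (≡.trans (≡.sym (inverseˡ σ)) (≡.trans (≡.cong (σ ⟨$⟩ˡ_) σr≡σs) (inverseˡ σ))) i≡j)
  act-cong σ (θ-square r i) = θ-square _ i

  Invariant : Pred Carrier (c ⊔ ℓ)
  Invariant f = ∀ σ → act σ f ≈ f

  p : Multiset m m′ → Carrier
  p S = sum λ r →
    product (λ k → x r k ^ S (plain k)) * product (λ j → θ r j ^ S (barred j))

  data GeneratedSubalgebra {g} (G : Pred Carrier g) : Pred Carrier (c ⊔ ℓ ⊔ g) where
    generator : ∀ {f} → G f → GeneratedSubalgebra G f
    scalar    : ∀ a → GeneratedSubalgebra G (const a)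
    sum-closed     : ∀ {f h} → GeneratedSubalgebra G f → GeneratedSubalgebra G h →
                     GeneratedSubalgebra G (f + h)
    product-closed : ∀ {f h} → GeneratedSubalgebra G f → GeneratedSubalgebra G h →
                     GeneratedSubalgebra G (f * h)
    ≈-closed       : ∀ {f h} → f ≈ h → GeneratedSubalgebra G f → GeneratedSubalgebra G h

{-# OPTIONS --safe #-}
module Submission where

-- A word w in the letters 1, …, m, 1̄, …, m̄′ has a value in each row r, and
-- P w denotes the sum of these values; up to a scalar, P w is zero or a
-- generator p S with |S| = |w|.  For words w₁, …, wₗ let M be the sum of
-- the products of the values of the wᵢ in rows rᵢ, over all pairwise distinct
-- r₁, …, rₗ.  Splitting a product M(w₁, …, wₗ) P(w) according to whether the
-- row of w is new gives
--   M(w₁, …, wₗ, w) = M(w₁, …, wₗ) P(w) - Σⱼ ± M(w₁, …, wⱼ w, …, wₗ).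
-- Hence M is a polynomial in the P's, in which P(w₁⋯wₗ) has coefficient
-- (-1)ˡ⁻¹ (l - 1)!.  For l = n + 1 there are no distinct rows, so M = 0, which
-- expresses P of a word of more than n letters by the P's of shorter words.
-- Finally n! f is the symmetrization of an invariant f, and symmetrizing a
-- monomial gives M of n words.

open import Defs
open import Algebra.Bundles using (CommutativeRing; Ring; Semiring)
open import Algebra.Morphism.Structures using (IsSemiringHomomorphism)
import Algebra.Properties.Group as GroupProperties
import Algebra.Properties.Ring as RingProperties
import Algebra.Properties.Monoid.Mult as MonoidMult
import Algebra.Properties.Monoid.Sum as MonoidSum
import Algebra.Properties.CommutativeMonoid.Sum as CommutativeMonoidSum
import Algebra.Properties.Semiring.Sum as SemiringSum
open import Data.Fin.Base using (Fin; zero; suc; punchIn)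
import Data.Fin.Properties as Fin
open import Data.Fin.Permutation as Permutation using (Permutation′; _⟨$⟩ʳ_)
open import Data.List.Base using (List; []; _∷_; _++_; length)
import Data.List.Properties as List
open import Data.Nat.Base as ℕ using (ℕ; zero; suc; _≤_; _<_; z≤n; s≤s)
open import Data.Nat.Induction using (<-rec)
import Data.Nat.Properties as ℕ
open import Data.Product.Base using (_,_; _×_; ∃-syntax; proj₁; proj₂)
open import Data.Product.Properties using (≡-dec)
open import Data.Rational.Base as ℚ using (ℚ; 0ℚ; 1ℚ)
import Data.Rational.Properties as ℚ
open import Data.Sum.Base using (_⊎_; [_,_])
open import Data.Vec.Base as Vec using (Vec; []; _∷_; _∷ʳ_; _[_]%=_; _[_]≔_)
open import Data.Vec.Functional using (updateAt)
open import Data.Vec.Relation.Unary.All using (All; []; _∷_)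
open import Function.Base using (_∘_; id)
open import Level using (_⊔_)
open import Relation.Binary.PropositionalEquality as ≡ using (_≡_)
import Relation.Binary.Reasoning.Setoid as SetoidReasoning
open import Relation.Nullary.Decidable using (yes; no)
open import Relation.Unary using (Pred; _≐_)

-- Multiplicities, and vectors of words.

open CommutativeMonoidSum ℕ.+-0-commutativeMonoid using () renaming (sum to Σℕ; sum-replicate-zero to Σℕ-zero)

Σℕ-updateAt-suc : ∀ {N} (S : Fin N → ℕ) j → Σℕ (updateAt S j suc) ≡ suc (Σℕ S)
Σℕ-updateAt-suc S zero    = ≡.refl
Σℕ-updateAt-suc S (suc j) =
  ≡.trans (≡.cong (S zero ℕ.+_) (Σℕ-updateAt-suc (S ∘ suc) j)) (ℕ.+-suc (S zero) _)

module _ {a} {A : Set a} where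

  flat : ∀ {k} → Vec (List A) k → List A
  flat []       = []
  flat (v ∷ vs) = v ++ flat vs

  flat-∷ʳ : ∀ {k} (vs : Vec (List A) k) w → flat (vs ∷ʳ w) ≡ flat vs ++ w
  flat-∷ʳ []       w = List.++-identityʳ w
  flat-∷ʳ (v ∷ vs) w =
    ≡.trans (≡.cong (v ++_) (flat-∷ʳ vs w)) (≡.sym (List.++-assoc v (flat vs) w))

  merge : ∀ {l} → Vec (List A) l → List A → Fin l → Vec (List A) l
  merge vs w j = vs [ j ]%= (_++ w)

  -- Merging only changes the order of the letters. Recursions that replace `vs ∷ʳ w` by a merge
  -- thus have one word fewer but the same total length.
  length-flat-merge : ∀ {l} (vs : Vec (List A) l) w j →
                      length (flat (merge vs w j)) ≡ length (flat (vs ∷ʳ w))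
  length-flat-merge (v ∷ vs) w zero = begin
    length ((v ++ w) ++ flat vs)          ≡⟨ ≡.cong length (List.++-assoc v w (flat vs)) ⟩
    length (v ++ w ++ flat vs)            ≡⟨ List.length-++ v ⟩
    length v ℕ.+ length (w ++ flat vs)    ≡⟨ ≡.cong (length v ℕ.+_) (List.length-++-comm w (flat vs)) ⟩
    length v ℕ.+ length (flat vs ++ w)    ≡⟨ ≡.cong (λ u → length v ℕ.+ length u) (flat-∷ʳ vs w) ⟨
    length v ℕ.+ length (flat (vs ∷ʳ w))  ≡⟨ List.length-++ v ⟨
    length (v ++ flat (vs ∷ʳ w))          ∎
    where open ≡.≡-Reasoning
  length-flat-merge (v ∷ vs) w (suc j) =
    ≡.trans (List.length-++ v)
      (≡.trans (≡.cong (length v ℕ.+_) (length-flat-merge vs w j)) (≡.sym (List.length-++ v)))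

  NonEmpty : List A → Set
  NonEmpty w = 0 < length w

  nonEmpty-∷ʳ⁻ : ∀ {l} (vs : Vec (List A) l) {w} →
                 All NonEmpty (vs ∷ʳ w) → All NonEmpty vs × NonEmpty w
  nonEmpty-∷ʳ⁻ []       (pw ∷ [])  = [] , pw
  nonEmpty-∷ʳ⁻ (v ∷ vs) (pv ∷ pvs) =
    let pvs′ , pw = nonEmpty-∷ʳ⁻ vs pvs in pv ∷ pvs′ , pw

  nonEmpty-++ : ∀ v w → NonEmpty v → NonEmpty (v ++ w)
  nonEmpty-++ (_ ∷ _) w _ = s≤s z≤n

  nonEmpty-merge : ∀ {l} {vs : Vec (List A) l} w j →
                   All NonEmpty vs → All NonEmpty (merge vs w j)
  nonEmpty-merge {vs = v ∷ vs} w zero    (pv ∷ pvs) = nonEmpty-++ v w pv ∷ pvs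
  nonEmpty-merge {vs = v ∷ vs} w (suc j) (pv ∷ pvs) = pv ∷ nonEmpty-merge w j pvs

  nonEmpty-flat : ∀ {l} (vs : Vec (List A) (suc l)) → All NonEmpty vs → NonEmpty (flat vs)
  nonEmpty-flat (v ∷ vs) (pv ∷ _) = nonEmpty-++ v (flat vs) pv

  -- The first `l` letters become words of their own, and the hypothesis leaves at least one letter
  -- for the last word. With `l = n` this provides one word more than there are rows.
  split : ∀ l (w : List A) → l < length w →
          ∃[ vs ] (All NonEmpty {n = suc l} vs × flat vs ≡ w)
  split zero    w       0<w       = w ∷ [] , 0<w ∷ [] , List.++-identityʳ w
  split (suc l) (a ∷ w) (s≤s l<w) =
    let vs , nonEmpty , vs≡w = split l w l<w in
    (a ∷ []) ∷ vs , s≤s z≤n ∷ nonEmpty , ≡.cong (a ∷_) vs≡w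

module PowerSums {c ℓ} (K : CommutativeRing c ℓ) (n m m′ : ℕ) where

  private
    module K = CommutativeRing K
    module KP = RingProperties K.ring

  open MonoidMult K.+-monoid using () renaming (_×_ to _×ᴷ_)

  open SuperPolynomials K n m m′
  open Ring ring
    using (setoid; semiring; *-monoid; +-group; +-congˡ; +-congʳ; *-congˡ; *-congʳ; zeroˡ; zeroʳ; +-identityʳ; -‿inverseʳ)
  open SemiringSum semiring
    using (sum-cong-≋; sum-remove; ∑-distrib-+; ∑-comm; sum-permute; *-distribˡ-sum; *-distribʳ-sum;
           sum-replicate-zero)
  open MonoidSum *-monoid using () renaming (sum-replicate-zero to product-1)
  open RingProperties ring using (-1*x≈-x; -‿+-comm)
  open GroupProperties +-group using (inverseˡ-unique)
  open SetoidReasoning setoid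

  -- Scalar multiples, and commutation up to a scalar.

  infixr 8 _•_

  _•_ : K.Carrier → Carrier → Carrier
  a • f = const a * f

  •-assoc : ∀ a b f → a • b • f ≈ (a K.* b) • f
  •-assoc a b f = trans (sym (*-assoc _ _ f)) (*-congʳ (sym (const-* a b)))

  •-congʳ : ∀ {a b f} → a K.≈ b → a • f ≈ b • f
  •-congʳ a≈b = *-congʳ (const-cong a≈b)

  *-•-comm : ∀ a f g → f * a • g ≈ a • (f * g)
  *-•-comm a f g = begin
    f * (const a * g)  ≈⟨ *-assoc f _ g ⟨
    f * const a * g    ≈⟨ *-congʳ (const-central a f) ⟨
    const a * f * g    ≈⟨ *-assoc _ f g ⟩
    const a * (f * g)  ∎

  -‿as-• : ∀ f → - f ≈ (K.- K.1#) • f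
  -‿as-• f = trans (sym (-1*x≈-x f)) (*-congʳ (sym (inverseˡ-unique _ _ (begin
    const (K.- K.1#) + const K.1#  ≈⟨ const-+ _ _ ⟨
    const (K.- K.1# K.+ K.1#)      ≈⟨ const-cong (K.-‿inverseˡ K.1#) ⟩
    const K.0#                     ∎))))

  -‿• : ∀ a f → (K.- a) • f ≈ - (a • f)
  -‿• a f = begin
    (K.- a) • f               ≈⟨ •-congʳ (KP.-1*x≈-x a) ⟨
    (K.- K.1# K.* a) • f      ≈⟨ •-assoc _ a f ⟨
    (K.- K.1#) • a • f        ≈⟨ -‿as-• (a • f) ⟨
    - (a • f)                 ∎

  sum-• : ∀ {k} a (f : Fin k → Carrier) → sum (λ i → a • f i) ≈ a • sum f
  sum-• a f = sym (*-distribˡ-sum (const a) f)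

  sum-constant : ∀ k f → sum {k} (λ _ → f) ≈ (k ×ᴷ K.1#) • f
  sum-constant zero    f = sym (zeroˡ f)
  sum-constant (suc k) f = begin
    f + sum {k} (λ _ → f)              ≈⟨ +-cong (sym (*-identityˡ f)) (sum-constant k f) ⟩
    K.1# • f + (k ×ᴷ K.1#) • f         ≈⟨ distribʳ f _ _ ⟨
    (const K.1# + const (k ×ᴷ K.1#)) * f  ≈⟨ *-congʳ (const-+ _ _) ⟨
    (suc k ×ᴷ K.1#) • f                ∎

  -- Signs are tracked only as scalars a with f * g ≈ a • (g * f); that they
  -- are ±1 is never needed.
  Skew : K.Carrier → Carrier → Carrier → Set (c ⊔ ℓ)
  Skew a f g = f * g ≈ a • (g * f)

  skew-1ˡ : ∀ f → Skew K.1# (const K.1#) f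
  skew-1ˡ f = *-congˡ (sym (*-identityʳ f))

  skew-1ʳ : ∀ f → Skew K.1# f (const K.1#)
  skew-1ʳ f = trans (*-identityʳ f) (sym (trans (*-identityˡ _) (*-identityˡ f)))

  skew-0ˡ : ∀ a f → Skew a (const K.0#) f
  skew-0ˡ a f = trans (zeroˡ f) (sym (trans (*-congˡ (zeroʳ f)) (zeroʳ _)))

  skew-*ˡ : ∀ {a b f g h} → Skew a f h → Skew b g h → Skew (a K.* b) (f * g) h
  skew-*ˡ {a} {b} {f} {g} {h} fh gh = begin
    f * g * h              ≈⟨ *-assoc f g h ⟩
    f * (g * h)            ≈⟨ *-congˡ gh ⟩
    f * b • (h * g)        ≈⟨ *-•-comm b f _ ⟩
    b • (f * (h * g))      ≈⟨ *-congˡ (*-assoc f h g) ⟨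
    b • (f * h * g)        ≈⟨ *-congˡ (*-congʳ fh) ⟩
    b • (a • (h * f) * g)  ≈⟨ *-congˡ (*-assoc _ _ g) ⟩
    b • a • (h * f * g)    ≈⟨ •-assoc b a _ ⟩
    (b K.* a) • (h * f * g)    ≈⟨ *-cong (const-cong (K.*-comm b a)) (*-assoc h f g) ⟩
    (a K.* b) • (h * (f * g))  ∎

  skew-*ʳ : ∀ {a b f g h} → Skew a f g → Skew b f h → Skew (a K.* b) f (g * h)
  skew-*ʳ {a} {b} {f} {g} {h} fg fh = begin
    f * (g * h)            ≈⟨ *-assoc f g h ⟨
    f * g * h              ≈⟨ *-congʳ fg ⟩
    a • (g * f) * h        ≈⟨ *-assoc _ _ h ⟩
    a • (g * f * h)        ≈⟨ *-congˡ (*-assoc g f h) ⟩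
    a • (g * (f * h))      ≈⟨ *-congˡ (*-congˡ fh) ⟩
    a • (g * b • (h * f))  ≈⟨ *-congˡ (*-•-comm b g _) ⟩
    a • b • (g * (h * f))  ≈⟨ •-assoc a b _ ⟩
    (a K.* b) • (g * (h * f))  ≈⟨ *-congˡ (*-assoc g h f) ⟨
    (a K.* b) • (g * h * f)    ∎

  skew-sum : ∀ {k a h} (f : Fin k → Carrier) → (∀ i → Skew a (f i) h) → Skew a (sum f) h
  skew-sum {a = a} {h} f fh = begin
    sum f * h                  ≈⟨ *-distribʳ-sum h f ⟩
    sum (λ i → f i * h)        ≈⟨ sum-cong-≋ fh ⟩
    sum (λ i → a • (h * f i))  ≈⟨ sum-• a (λ i → h * f i) ⟩
    a • sum (λ i → h * f i)    ≈⟨ *-congˡ (*-distribˡ-sum h f) ⟨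
    a • (h * sum f)            ∎

  skew-congˡ : ∀ {a b f g} → a K.≈ b → Skew a f g → Skew b f g
  skew-congˡ a≈b fg = trans fg (•-congʳ a≈b)

  -- Words, their values in a row, and the scalars for exchanging them.

  Letter : Set
  Letter = Fin m ⊎ Fin m′

  Word : Set
  Word = List Letter

  letter : Fin n → Letter → Carrier
  letter r (plain k)  = x r k
  letter r (barred j) = θ r j

  ev : Fin n → Word → Carrier
  ev r []      = const K.1#
  ev r (l ∷ w) = letter r l * ev r w

  ev-++ : ∀ r v w → ev r (v ++ w) ≈ ev r v * ev r w
  ev-++ r []      w = sym (*-identityˡ _)
  ev-++ r (l ∷ v) w = trans (*-congˡ (ev-++ r v w)) (sym (*-assoc _ _ _))

  -- The scalar is a function of the letters alone and is the same for all rows, so it can be taken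
  -- out of sums over rows.
  letterSign : Letter → Letter → K.Carrier
  letterSign (plain _)  _          = K.1#
  letterSign (barred _) (plain _)  = K.1#
  letterSign (barred _) (barred _) = K.- K.1#

  -- The two rows may coincide: θ anticommutes with itself, as θ² = 0.
  letter-skew : ∀ r a s b → Skew (letterSign a b) (letter r a) (letter s b)
  letter-skew r (plain k)  s (plain l)  = trans (x-x-commute r k s l) (sym (*-identityˡ _))
  letter-skew r (plain k)  s (barred j) = trans (x-θ-commute r k s j) (sym (*-identityˡ _))
  letter-skew r (barred i) s (plain l)  = trans (sym (x-θ-commute s l r i)) (sym (*-identityˡ _))
  letter-skew r (barred i) s (barred j) with ≡-dec Fin._≟_ Fin._≟_ (r , i) (s , j)
  ... | yes ≡.refl = trans (θ-square r i) (sym (trans (*-congˡ (θ-square r i)) (zeroʳ _)))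
  ... | no ri≢sj   = trans (θ-θ-anticommute r i s j ri≢sj) (-‿as-• _)

  letterWordSign : Letter → Word → K.Carrier
  letterWordSign a []      = K.1#
  letterWordSign a (b ∷ w) = letterSign a b K.* letterWordSign a w

  wordSign : Word → Word → K.Carrier
  wordSign []      w = K.1#
  wordSign (a ∷ v) w = letterWordSign a w K.* wordSign v w

  letter-word-skew : ∀ r a s w → Skew (letterWordSign a w) (letter r a) (ev s w)
  letter-word-skew r a s []      = skew-1ʳ _
  letter-word-skew r a s (b ∷ w) = skew-*ʳ (letter-skew r a s b) (letter-word-skew r a s w)

  word-skew : ∀ r v s w → Skew (wordSign v w) (ev r v) (ev s w)
  word-skew r []      s w = skew-1ˡ _
  word-skew r (a ∷ v) s w = skew-*ˡ (letter-word-skew r a s w) (word-skew r v s w)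

  wordSign-++ˡ : ∀ u v w → wordSign u w K.* wordSign v w K.≈ wordSign (u ++ v) w
  wordSign-++ˡ []      v w = K.*-identityˡ _
  wordSign-++ˡ (a ∷ u) v w = K.trans (K.*-assoc _ _ _) (K.*-congˡ (wordSign-++ˡ u v w))

  -- Power sums of words, and sums over distinct indices.

  -- Rows enter through an index map `φ`, so that inductions can remove an index by composing with
  -- `punchIn`.
  P : ∀ {k} → (Fin k → Fin n) → Word → Carrier
  P φ w = sum λ i → ev (φ i) w

  -- M φ (w₁ ∷ … ∷ wₗ ∷ []) is the sum of ev (φ i₁) w₁ * … * ev (φ iₗ) wₗ over
  -- all pairwise distinct i₁, …, iₗ.
  M : ∀ {k l} → (Fin k → Fin n) → Vec Word l → Carrier
  M           φ []       = const K.1#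
  M {zero}    φ (w ∷ ws) = const K.0#
  M {suc k}   φ (w ∷ ws) = sum λ i → ev (φ i) w * M (φ ∘ punchIn i) ws

  -- Every term of `M φ vs` is a product of values of the same words in the same order. All terms
  -- therefore exchange with `ev s w` at the cost of one scalar, that of the concatenation
  -- `flat vs`.
  M-skew : ∀ {k l} (φ : Fin k → Fin n) (vs : Vec Word l) s w →
           Skew (wordSign (flat vs) w) (M φ vs) (ev s w)
  M-skew           φ []       s w = skew-1ˡ _
  M-skew {zero}    φ (v ∷ vs) s w = skew-0ˡ _ _
  M-skew {suc k}   φ (v ∷ vs) s w = skew-sum _ λ i →
    skew-congˡ (wordSign-++ˡ v (flat vs) w)
      (skew-*ˡ (word-skew (φ i) v s w) (M-skew (φ ∘ punchIn i) vs s w))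

  -- The pigeonhole principle: each word uses up an index, and the recursion meets an empty index
  -- set while words remain.
  M-vanishes : ∀ {k l} (φ : Fin k → Fin n) (vs : Vec Word l) → k < l → M φ vs ≈ const K.0#
  M-vanishes {zero}  φ (v ∷ vs) _         = refl
  M-vanishes {suc k} φ (v ∷ vs) (s≤s k<l) = begin
    sum (λ i → ev (φ i) v * M (φ ∘ punchIn i) vs)
      ≈⟨ sum-cong-≋ vanish ⟩
    sum {suc k} (λ _ → const K.0#)
      ≈⟨ sum-replicate-zero (suc k) ⟩
    const K.0#  ∎
    where
    vanish : ∀ i → ev (φ i) v * M (φ ∘ punchIn i) vs ≈ const K.0#
    vanish i = trans (*-congˡ (M-vanishes (φ ∘ punchIn i) vs k<l)) (zeroʳ _)

  M-[-] : ∀ {k} (φ : Fin k → Fin n) w → M φ (w ∷ []) ≈ P φ w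
  M-[-] {zero}  φ w = refl
  M-[-] {suc k} φ w = sum-cong-≋ λ i → *-identityʳ (ev (φ i) w)

  -- The scalar for moving `w` from the far right leftwards past all words after the one at position
  -- `j`.
  mergeSign : ∀ {l} → Vec Word l → Word → Fin l → K.Carrier
  mergeSign (v ∷ vs) w zero    = wordSign (flat vs) w
  mergeSign (v ∷ vs) w (suc j) = mergeSign vs w j

  -- In M φ vs * P φ w, the index of w either differs from all the indices
  -- of vs or equals exactly one of them.
  M-* : ∀ {k l} (φ : Fin k → Fin n) (vs : Vec Word l) w →
        M φ vs * P φ w ≈ M φ (vs ∷ʳ w) + sum (λ j → mergeSign vs w j • M φ (merge vs w j))
  M-* φ [] w = trans (*-identityˡ _) (trans (sym (M-[-] φ w)) (sym (+-identityʳ _)))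
  M-* {zero} {suc l} φ (v ∷ vs) w = begin
    const K.0# * const K.0#  ≈⟨ zeroʳ (const K.0#) ⟩
    const K.0#               ≈⟨ sum-replicate-zero (suc l) ⟨
    sum {suc l} (λ _ → const K.0#)
      ≈⟨ sum-cong-≋ {suc l} vanish ⟩
    sum (λ j → mergeSign (v ∷ vs) w j • M φ (merge (v ∷ vs) w j))
      ≈⟨ +-identityˡ _ ⟨
    const K.0# + sum (λ j → mergeSign (v ∷ vs) w j • M φ (merge (v ∷ vs) w j))  ∎
    where
    vanish : ∀ j → const K.0# ≈ mergeSign (v ∷ vs) w j • M φ (merge (v ∷ vs) w j)
    vanish zero    = sym (zeroʳ _)
    vanish (suc j) = sym (zeroʳ _)
  M-* {suc k} φ (v ∷ vs) w = begin
    sum (λ i → ev (φ i) v * M (φᵢ i) vs) * P φ w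
      ≈⟨ *-distribʳ-sum (P φ w) (λ i → ev (φ i) v * M (φᵢ i) vs) ⟩
    sum (λ i → ev (φ i) v * M (φᵢ i) vs * P φ w)
      ≈⟨ sum-cong-≋ expand ⟩
    sum (λ i → A i + (B i + C i))
      ≈⟨ trans (∑-distrib-+ A (λ i → B i + C i)) (+-congˡ (∑-distrib-+ B C)) ⟩
    sum A + (sum B + sum C)
      ≈⟨ +-assoc (sum A) (sum B) (sum C) ⟨
    sum A + sum B + sum C
      ≈⟨ +-congʳ (+-comm (sum A) (sum B)) ⟩
    sum B + sum A + sum C
      ≈⟨ +-assoc (sum B) (sum A) (sum C) ⟩
    sum B + (sum A + sum C)
      -- `sum A` is the merge of `w` into `v`, the summand at `zero`; `sum C` gives the summands at
      -- `suc j`.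
      ≈⟨ +-congˡ (+-cong (sum-• _ (λ i → ev (φ i) (v ++ w) * M (φᵢ i) vs)) exchange) ⟩
    M φ (v ∷ (vs ∷ʳ w)) + sum (λ j → mergeSign (v ∷ vs) w j • M φ (merge (v ∷ vs) w j))  ∎
    where
    φᵢ : ∀ i → Fin k → Fin n
    φᵢ i = φ ∘ punchIn i

    -- With `i` the index of `v`, the index of `w` equals `i` in `A`, is new in `B`, and is that of
    -- a word of `vs` in `C`.
    A B C : Fin (suc k) → Carrier
    A i = wordSign (flat vs) w • (ev (φ i) (v ++ w) * M (φᵢ i) vs)
    B i = ev (φ i) v * M (φᵢ i) (vs ∷ʳ w)
    C i = ev (φ i) v * sum (λ j → mergeSign vs w j • M (φᵢ i) (merge vs w j))

    same : ∀ i → ev (φ i) v * (M (φᵢ i) vs * ev (φ i) w) ≈ A i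
    same i = begin
      ev (φ i) v * (M (φᵢ i) vs * ev (φ i) w)
        ≈⟨ *-congˡ (M-skew (φᵢ i) vs (φ i) w) ⟩
      ev (φ i) v * wordSign (flat vs) w • (ev (φ i) w * M (φᵢ i) vs)
        ≈⟨ *-•-comm _ _ _ ⟩
      wordSign (flat vs) w • (ev (φ i) v * (ev (φ i) w * M (φᵢ i) vs))
        ≈⟨ *-congˡ (trans (sym (*-assoc _ _ _)) (*-congʳ (sym (ev-++ (φ i) v w)))) ⟩
      A i  ∎

    expand : ∀ i → ev (φ i) v * M (φᵢ i) vs * P φ w ≈ A i + (B i + C i)
    expand i = begin
      ev (φ i) v * M (φᵢ i) vs * P φ w
        ≈⟨ *-assoc _ _ _ ⟩
      ev (φ i) v * (M (φᵢ i) vs * P φ w)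
        -- Separating the summand of `P φ w` at `i` leaves the power sum over the remaining indices,
        -- to which the induction hypothesis applies.
        ≈⟨ *-congˡ (*-congˡ (sum-remove {i = i} (λ i → ev (φ i) w))) ⟩
      ev (φ i) v * (M (φᵢ i) vs * (ev (φ i) w + P (φᵢ i) w))
        ≈⟨ *-congˡ (distribˡ _ _ _) ⟩
      ev (φ i) v * (M (φᵢ i) vs * ev (φ i) w + M (φᵢ i) vs * P (φᵢ i) w)
        ≈⟨ distribˡ _ _ _ ⟩
      ev (φ i) v * (M (φᵢ i) vs * ev (φ i) w) + ev (φ i) v * (M (φᵢ i) vs * P (φᵢ i) w)
        ≈⟨ +-cong (same i) (trans (*-congˡ (M-* (φᵢ i) vs w)) (distribˡ _ _ _)) ⟩
      A i + (B i + C i)  ∎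

    exchange : sum C ≈ sum (λ j → mergeSign vs w j • M φ (v ∷ merge vs w j))
    exchange = begin
      sum C
        ≈⟨ sum-cong-≋ pull ⟩
      sum (λ i → sum λ j → mergeSign vs w j • (ev (φ i) v * M (φᵢ i) (merge vs w j)))
        ≈⟨ ∑-comm (λ i j → mergeSign vs w j • (ev (φ i) v * M (φᵢ i) (merge vs w j))) ⟩
      sum (λ j → sum λ i → mergeSign vs w j • (ev (φ i) v * M (φᵢ i) (merge vs w j)))
        ≈⟨ sum-cong-≋ (λ j → sum-• (mergeSign vs w j) (λ i → ev (φ i) v * M (φᵢ i) (merge vs w j))) ⟩
      sum (λ j → mergeSign vs w j • M φ (v ∷ merge vs w j))  ∎
      where
      pull : ∀ i → C i ≈ sum (λ j → mergeSign vs w j • (ev (φ i) v * M (φᵢ i) (merge vs w j)))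
      pull i = trans
        (*-distribˡ-sum (ev (φ i) v) (λ j → mergeSign vs w j • M (φᵢ i) (merge vs w j)))
        (sum-cong-≋ λ j → *-•-comm (mergeSign vs w j) (ev (φ i) v) (M (φᵢ i) (merge vs w j)))

  -- Within a single row, moving `w` back to the end costs exactly `mergeSign`. All merges thus give
  -- the same power sum, and in `M-leading` their contributions add up instead of cancelling.
  ev-flat-merge : ∀ {l} r (vs : Vec Word l) w j →
                  mergeSign vs w j • ev r (flat (merge vs w j)) ≈ ev r (flat vs ++ w)
  ev-flat-merge r (v ∷ vs) w zero = begin
    s • ev r ((v ++ w) ++ flat vs)        ≡⟨ ≡.cong (λ u → s • ev r u) (List.++-assoc v w (flat vs)) ⟩
    s • ev r (v ++ w ++ flat vs)          ≈⟨ *-congˡ (trans (ev-++ r v _) (*-congˡ (ev-++ r w (flat vs)))) ⟩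
    s • (ev r v * (ev r w * ev r (flat vs)))  ≈⟨ *-•-comm s (ev r v) _ ⟨
    ev r v * s • (ev r w * ev r (flat vs))    ≈⟨ *-congˡ (word-skew r (flat vs) r w) ⟨
    ev r v * (ev r (flat vs) * ev r w)    ≈⟨ trans (ev-++ r v _) (*-congˡ (ev-++ r (flat vs) w)) ⟨
    ev r (v ++ flat vs ++ w)              ≡⟨ ≡.cong (ev r) (List.++-assoc v (flat vs) w) ⟨
    ev r ((v ++ flat vs) ++ w)            ∎
    where
    s : K.Carrier
    s = wordSign (flat vs) w
  ev-flat-merge r (v ∷ vs) w (suc j) = begin
    s • ev r (v ++ flat (merge vs w j))      ≈⟨ *-congˡ (ev-++ r v _) ⟩
    s • (ev r v * ev r (flat (merge vs w j)))  ≈⟨ *-•-comm s (ev r v) _ ⟨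
    ev r v * s • ev r (flat (merge vs w j))  ≈⟨ *-congˡ (ev-flat-merge r vs w j) ⟩
    ev r v * ev r (flat vs ++ w)             ≈⟨ ev-++ r v _ ⟨
    ev r (v ++ flat vs ++ w)                 ≡⟨ ≡.cong (ev r) (List.++-assoc v (flat vs) w) ⟨
    ev r ((v ++ flat vs) ++ w)               ∎
    where
    s : K.Carrier
    s = mergeSign vs w j

  P-flat-merge : ∀ {k l} (φ : Fin k → Fin n) (vs : Vec Word l) w j →
                 mergeSign vs w j • P φ (flat (merge vs w j)) ≈ P φ (flat vs ++ w)
  P-flat-merge φ vs w j =
    trans (sym (sum-• (mergeSign vs w j) (λ i → ev (φ i) (flat (merge vs w j)))))
      (sum-cong-≋ λ i → ev-flat-merge (φ i) vs w j)

  -- Recursion for `M` inside the generated subalgebra.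

  Generator : Pred Carrier (c ⊔ ℓ)
  Generator f = ∃[ S ] (NoRepeatedBarred S × size S ≤ n × f ≈ p S)

  G : Pred Carrier (c ⊔ ℓ)
  G = GeneratedSubalgebra Generator

  •-closed : ∀ {f} a → G f → G (a • f)
  •-closed a = product-closed (scalar a)

  -‿closed : ∀ {f} → G f → G (- f)
  -‿closed Gf = ≈-closed (sym (-‿as-• _)) (•-closed _ Gf)

  Σ-closed : ∀ {k} (f : Fin k → Carrier) → (∀ i → G (f i)) → G (sum f)
  Σ-closed {zero}  f Gf = scalar K.0#
  Σ-closed {suc k} f Gf = sum-closed (Gf zero) (Σ-closed (f ∘ suc) (Gf ∘ suc))

  M-∷ʳ : ∀ {k l} (φ : Fin k → Fin n) (vs : Vec Word l) w →
         M φ (vs ∷ʳ w) ≈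
         M φ vs * P φ w + - sum (λ j → mergeSign vs w j • M φ (merge vs w j))
  M-∷ʳ φ vs w = begin
    M φ (vs ∷ʳ w)                     ≈⟨ +-identityʳ _ ⟨
    M φ (vs ∷ʳ w) + const K.0#        ≈⟨ +-congˡ (-‿inverseʳ X) ⟨
    M φ (vs ∷ʳ w) + (X + - X)         ≈⟨ +-assoc _ X (- X) ⟨
    M φ (vs ∷ʳ w) + X + - X           ≈⟨ +-congʳ (M-* φ vs w) ⟨
    M φ vs * P φ w + - X              ∎
    where
    X : Carrier
    X = sum (λ j → mergeSign vs w j • M φ (merge vs w j))

  -- Recursion on the number of words: `vs` and all its merges with `w` have one word fewer than
  -- `vs ∷ʳ w`, and their total length stays below `N`. So do the lengths of all words whose power
  -- sums occur.
  M∈G : ∀ N → (∀ w → length w < N → G (P id w)) →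
        ∀ {l} (vs : Vec Word l) → length (flat vs) < N → G (M id vs)
  M∈G N small {zero}  []  _ = scalar K.1#
  M∈G N small {suc l} vs′ lt with Vec.initLast vs′
  ... | vs , w , ≡.refl =
    ≈-closed (sym (M-∷ʳ id vs w))
      (sum-closed
        (product-closed (M∈G N small vs vs<N) (small w w<N))
        (-‿closed (Σ-closed _ λ j → •-closed (mergeSign vs w j)
          (M∈G N small (merge vs w j) (≡.subst (_< N) (≡.sym (length-flat-merge vs w j)) lt)))))
    where
    sum<N : length (flat vs) ℕ.+ length w < N
    sum<N = ≡.subst (_< N) (≡.trans (≡.cong length (flat-∷ʳ vs w)) (List.length-++ (flat vs))) lt
    vs<N = ℕ.≤-<-trans (ℕ.m≤m+n _ _) sum<N
    w<N  = ℕ.≤-<-trans (ℕ.m≤n+m _ _) sum<N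

  -- Minus the coefficient of P(w₁⋯wₗ₊₁) in M(w₁, …, wₗ₊₁).
  leading : ℕ → K.Carrier
  leading zero    = K.- K.1#
  leading (suc l) = K.- ((suc l ×ᴷ K.1#) K.* leading l)

  -- As `vs` and `w` are nonempty, both factors of `M id vs * P id w` involve fewer than `N` letters
  -- and lie in `G`. By induction each merge is, modulo `G`, the same multiple of the power sum of
  -- its concatenation. These `l + 1` equal contributions explain the recursion for `leading`.
  M-leading : ∀ N → (∀ w → length w < N → G (P id w)) →
              ∀ {l} (vs : Vec Word (suc l)) → All NonEmpty vs → length (flat vs) ≡ N →
              G (M id vs + leading l • P id (flat vs))
  M-leading N small {zero} (w ∷ []) _ _ = ≈-closed (sym cancel) (scalar K.0#)
    where
    cancel : M id (w ∷ []) + (K.- K.1#) • P id (w ++ []) ≈ const K.0#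
    cancel = begin
      M id (w ∷ []) + (K.- K.1#) • P id (w ++ [])
        ≈⟨ +-cong (M-[-] id w) (sym (-‿as-• _)) ⟩
      P id w + - P id (w ++ [])
        ≡⟨ ≡.cong (λ u → P id w + - P id u) (List.++-identityʳ w) ⟩
      P id w + - P id w
        ≈⟨ -‿inverseʳ _ ⟩
      const K.0#  ∎
  M-leading N small {suc l} vs′ nonEmpty |vs′|≡N with Vec.initLast vs′
  ... | vs , w , ≡.refl =
    ≈-closed (sym rearranged)
      (sum-closed
        (product-closed (M∈G N small vs vs<N) (small w w<N))
        (-‿closed (Σ-closed Z λ j → •-closed (mergeSign vs w j)
          (M-leading N small (merge vs w j) (nonEmpty-merge w j (proj₁ nonEmpty′))
            (≡.trans (length-flat-merge vs w j) |vs′|≡N)))))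
    where
    nonEmpty′ = nonEmpty-∷ʳ⁻ vs nonEmpty

    |vs|+|w|≡N : length (flat vs) ℕ.+ length w ≡ N
    |vs|+|w|≡N =
      ≡.trans (≡.sym (≡.trans (≡.cong length (flat-∷ʳ vs w)) (List.length-++ (flat vs)))) |vs′|≡N

    vs<N : length (flat vs) < N
    vs<N = ≡.subst (length (flat vs) <_) |vs|+|w|≡N (ℕ.m<m+n _ (proj₂ nonEmpty′))

    w<N : length w < N
    w<N = ≡.subst (length w <_) |vs|+|w|≡N (ℕ.m<n+m _ (nonEmpty-flat vs (proj₁ nonEmpty′)))

    F : Carrier
    F = P id (flat vs ++ w)

    -- The induction hypothesis puts the summands of `Z`, not those of `X`, in `G`. The difference
    -- `sum Y` is a multiple of `F`, which `leading (suc l)` is made to absorb.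
    X Y Z : Fin (suc l) → Carrier
    X j = mergeSign vs w j • M id (merge vs w j)
    Y j = mergeSign vs w j • leading l • P id (flat (merge vs w j))
    Z j = mergeSign vs w j • (M id (merge vs w j) + leading l • P id (flat (merge vs w j)))

    sumY : sum Y ≈ ((suc l ×ᴷ K.1#) K.* leading l) • F
    sumY = begin
      sum Y
        ≈⟨ sum-cong-≋ (λ j → trans (*-•-comm (leading l) _ _) (*-congˡ (P-flat-merge id vs w j))) ⟩
      sum {suc l} (λ _ → leading l • F)
        ≈⟨ sum-constant (suc l) (leading l • F) ⟩
      (suc l ×ᴷ K.1#) • leading l • F
        ≈⟨ •-assoc _ _ F ⟩
      ((suc l ×ᴷ K.1#) K.* leading l) • F  ∎

    sumZ : sum Z ≈ sum X + sum Y
    sumZ = trans (sum-cong-≋ Z≈X+Y) (∑-distrib-+ X Y)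
      where
      Z≈X+Y : ∀ j → Z j ≈ X j + Y j
      Z≈X+Y j = distribˡ _ _ _

    rearranged : M id (vs ∷ʳ w) + leading (suc l) • P id (flat (vs ∷ʳ w)) ≈
                 M id vs * P id w + - sum Z
    rearranged = begin
      M id (vs ∷ʳ w) + leading (suc l) • P id (flat (vs ∷ʳ w))
        ≡⟨ ≡.cong (λ u → M id (vs ∷ʳ w) + leading (suc l) • P id u) (flat-∷ʳ vs w) ⟩
      M id (vs ∷ʳ w) + leading (suc l) • F
        ≈⟨ +-cong (M-∷ʳ id vs w) (trans (-‿• _ F) (-‿cong (sym sumY))) ⟩
      M id vs * P id w + - sum X + - sum Y
        ≈⟨ +-assoc _ (- sum X) (- sum Y) ⟩
      M id vs * P id w + (- sum X + - sum Y)
        ≈⟨ +-congˡ (trans (-‿+-comm _ _) (-‿cong (sym sumZ))) ⟩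
      M id vs * P id w + - sum Z  ∎

  -- From power sums of words to the generators `p S`.

  -- The scalar is chosen before the row, so that sorting the letters of a word multiplies the whole
  -- sum over rows by one scalar.
  UniformlySkew : (f g : Fin n → Carrier) → Set (c ⊔ ℓ)
  UniformlySkew f g = ∃[ a ] (∀ r → Skew a (f r) (g r))

  uniformlySkew-^ʳ : ∀ {f g} → UniformlySkew f g → ∀ e → UniformlySkew f (λ r → g r ^ e)
  uniformlySkew-^ʳ fg zero    = K.1# , λ r → skew-1ʳ _
  uniformlySkew-^ʳ fg (suc e) =
    let a , fg′ = fg
        b , fgᵉ = uniformlySkew-^ʳ fg e
    in a K.* b , λ r → skew-*ʳ (fg′ r) (fgᵉ r)

  uniformlySkew-productʳ : ∀ {N f} (y : Fin N → Fin n → Carrier) → (∀ i → UniformlySkew f (y i)) →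
                           UniformlySkew f (λ r → product (λ i → y i r))
  uniformlySkew-productʳ {zero}  y fy = K.1# , λ r → skew-1ʳ _
  uniformlySkew-productʳ {suc N} y fy =
    let a , fy₀ = fy zero
        b , fyₛ = uniformlySkew-productʳ (y ∘ suc) (fy ∘ suc)
    in a K.* b , λ r → skew-*ʳ (fy₀ r) (fyₛ r)

  -- An insertion step of sorting: the new factor passes the powers of the earlier variables until
  -- it reaches its own power, and the scalars of these exchanges multiply to `b`.
  *-product-^ : ∀ {N} (y : Fin N → Fin n → Carrier) → (∀ i j → UniformlySkew (y i) (y j)) →
                ∀ (S : Fin N → ℕ) j →
                ∃[ b ] (∀ r → y j r * product (λ i → y i r ^ S i) ≈
                              b • product (λ i → y i r ^ updateAt S j suc i))
  *-product-^ y yy S zero =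
    K.1# , λ r → trans (sym (*-assoc _ _ _)) (sym (*-identityˡ _))
  *-product-^ y yy S (suc j) =
    let a , swap = uniformlySkew-^ʳ (yy (suc j) zero) (S zero)
        b , rec  = *-product-^ (y ∘ suc) (λ i j → yy (suc i) (suc j)) (S ∘ suc) j
    in a K.* b , λ r → begin
      y (suc j) r * (y zero r ^ S zero * product (λ i → y (suc i) r ^ S (suc i)))
        ≈⟨ *-assoc _ _ _ ⟨
      y (suc j) r * y zero r ^ S zero * product (λ i → y (suc i) r ^ S (suc i))
        ≈⟨ *-congʳ (swap r) ⟩
      a • (y zero r ^ S zero * y (suc j) r) * product (λ i → y (suc i) r ^ S (suc i))
        ≈⟨ trans (*-assoc _ _ _) (*-congˡ (*-assoc _ _ _)) ⟩
      a • (y zero r ^ S zero * (y (suc j) r * product (λ i → y (suc i) r ^ S (suc i))))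
        ≈⟨ *-congˡ (trans (*-congˡ (rec r)) (*-•-comm _ _ _)) ⟩
      a • b • (y zero r ^ S zero * product (λ i → y (suc i) r ^ updateAt (S ∘ suc) j suc i))
        ≈⟨ •-assoc a b _ ⟩
      (a K.* b) • (y zero r ^ S zero * product (λ i → y (suc i) r ^ updateAt (S ∘ suc) j suc i))  ∎

  product-zero : ∀ {N} (f : Fin N → Carrier) i → f i ≈ const K.0# → product f ≈ const K.0#
  product-zero f zero    fᵢ≈0 = trans (*-congʳ fᵢ≈0) (zeroˡ _)
  product-zero f (suc i) fᵢ≈0 = trans (*-congˡ (product-zero (f ∘ suc) i fᵢ≈0)) (zeroʳ _)

  monomial : Fin n → Multiset m m′ → Carrier
  monomial r S = product (λ k → x r k ^ S (plain k)) * product (λ j → θ r j ^ S (barred j))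

  plainContent : Word → Fin m → ℕ
  plainContent []             = λ _ → 0
  plainContent (plain k ∷ w)  = updateAt (plainContent w) k suc
  plainContent (barred j ∷ w) = plainContent w

  barredContent : Word → Fin m′ → ℕ
  barredContent []             = λ _ → 0
  barredContent (plain k ∷ w)  = barredContent w
  barredContent (barred j ∷ w) = updateAt (barredContent w) j suc

  content : Word → Multiset m m′
  content w = [ plainContent w , barredContent w ]

  size-content : ∀ w → size (content w) ≡ length w
  size-content [] = ≡.cong₂ ℕ._+_ (Σℕ-zero m) (Σℕ-zero m′)
  size-content (plain k ∷ w) =
    ≡.trans (≡.cong (ℕ._+ Σℕ (barredContent w)) (Σℕ-updateAt-suc (plainContent w) k))
      (≡.cong suc (size-content w))
  size-content (barred j ∷ w) =
    ≡.trans (≡.cong (Σℕ (plainContent w) ℕ.+_) (Σℕ-updateAt-suc (barredContent w) j))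
      (≡.trans (ℕ.+-suc (Σℕ (plainContent w)) _) (≡.cong suc (size-content w)))

  -- Letters are inserted one by one into a sorted monomial; a barred letter first passes all plain
  -- factors. A barred letter may repeat, in which case both sides are zero.
  ev≈monomial : ∀ w → ∃[ b ] (∀ r → ev r w ≈ b • monomial r (content w))
  ev≈monomial [] = K.1# , λ r →
    sym (trans (*-identityˡ _) (trans (*-cong (product-1 m) (product-1 m′)) (*-identityˡ _)))
  ev≈monomial (plain k ∷ w) =
    let b , ev≈ = ev≈monomial w
        d , xX≈ = *-product-^ (λ k r → x r k)
                    (λ k l → K.1# , λ r → letter-skew r (plain k) r (plain l))
                    (plainContent w) k
    in b K.* d , λ r → begin
      x r k * ev r w                                 ≈⟨ *-congˡ (ev≈ r) ⟩
      x r k * b • monomial r (content w)             ≈⟨ *-•-comm _ _ _ ⟩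
      b • (x r k * monomial r (content w))           ≈⟨ *-congˡ (sym (*-assoc _ _ _)) ⟩
      b • (x r k * product (λ l → x r l ^ plainContent w l) * product (λ j → θ r j ^ barredContent w j))
                                                     ≈⟨ *-congˡ (trans (*-congʳ (xX≈ r)) (*-assoc _ _ _)) ⟩
      b • d • monomial r (content (plain k ∷ w))     ≈⟨ •-assoc b d _ ⟩
      (b K.* d) • monomial r (content (plain k ∷ w))  ∎
  ev≈monomial (barred j ∷ w) =
    let b , ev≈ = ev≈monomial w
        a , θX≈ = uniformlySkew-productʳ (λ k r → x r k ^ plainContent w k)
                    (λ k → uniformlySkew-^ʳ (K.1# , λ r → letter-skew r (barred j) r (plain k)) (plainContent w k))
        d , θΘ≈ = *-product-^ (λ j r → θ r j) (λ i j → K.- K.1# , λ r → letter-skew r (barred i) r (barred j))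
                    (barredContent w) j
        X = λ r → product (λ k → x r k ^ plainContent w k)
        Θ = λ r → product (λ i → θ r i ^ barredContent w i)
    in b K.* (a K.* d) , λ r → begin
      θ r j * ev r w                     ≈⟨ *-congˡ (ev≈ r) ⟩
      θ r j * b • (X r * Θ r)            ≈⟨ *-•-comm _ _ _ ⟩
      b • (θ r j * (X r * Θ r))          ≈⟨ *-congˡ (sym (*-assoc _ _ _)) ⟩
      b • (θ r j * X r * Θ r)            ≈⟨ *-congˡ (*-congʳ (θX≈ r)) ⟩
      b • (a • (X r * θ r j) * Θ r)      ≈⟨ *-congˡ (trans (*-assoc _ _ _) (*-congˡ (*-assoc _ _ _))) ⟩
      b • a • (X r * (θ r j * Θ r))      ≈⟨ *-congˡ (*-congˡ (trans (*-congˡ (θΘ≈ r)) (*-•-comm _ _ _))) ⟩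
      b • a • d • monomial r (content (barred j ∷ w))        ≈⟨ *-congˡ (•-assoc a d _) ⟩
      b • (a K.* d) • monomial r (content (barred j ∷ w))    ≈⟨ •-assoc b _ _ ⟩
      (b K.* (a K.* d)) • monomial r (content (barred j ∷ w))  ∎

  θ-^ : ∀ r j {e} → 1 < e → θ r j ^ e ≈ const K.0#
  θ-^ r j (s≤s (s≤s _)) = trans (sym (*-assoc _ _ _)) (trans (*-congʳ (θ-square r j)) (zeroˡ _))

  -- A multiset with a repeated barred entry indexes no generator, but then every summand of `p S`
  -- contains the square of some θ, and `p S` is zero.
  p∈G : ∀ S → size S ≤ n → G (p S)
  p∈G S |S|≤n with Fin.all? (λ j → S (barred j) ℕ.≤? 1)
  ... | yes noRepeated = generator (S , noRepeated , |S|≤n , refl)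
  ... | no repeated    = ≈-closed (sym p≈0) (scalar K.0#)
    where
    p≈0 : p S ≈ const K.0#
    p≈0 =
      let j , Sⱼ≰1 = Fin.¬∀⟶∃¬ m′ _ (λ j → S (barred j) ℕ.≤? 1) repeated
          monomial≈0 : ∀ r → monomial r S ≈ const K.0#
          monomial≈0 r = trans (*-congˡ (product-zero _ j (θ-^ r j (ℕ.≰⇒> Sⱼ≰1)))) (zeroʳ _)
      in trans (sum-cong-≋ monomial≈0) (sum-replicate-zero n)

  P∈G-short : ∀ w → length w ≤ n → G (P id w)
  P∈G-short w |w|≤n =
    let b , ev≈ = ev≈monomial w in
    ≈-closed (sym (trans (sum-cong-≋ ev≈) (sum-• b (λ r → monomial r (content w)))))
      (•-closed b (p∈G (content w) (≡.subst (_≤ n) (≡.sym (size-content w)) |w|≤n)))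

  -- Monomials grouped by rows span the algebra.

  -- One word for each index: with `φ = id` this is a monomial whose factors are collected row by
  -- row, the shape that symmetrizes to `M`.
  mono : ∀ {k} → (Fin k → Fin n) → Vec Word k → Carrier
  mono φ []       = const K.1#
  mono φ (w ∷ ws) = ev (φ zero) w * mono (φ ∘ suc) ws

  mono-skew : ∀ {k} (φ : Fin k → Fin n) ws s v → Skew (wordSign (flat ws) v) (mono φ ws) (ev s v)
  mono-skew φ []       s v = skew-1ˡ _
  mono-skew φ (w ∷ ws) s v = skew-congˡ (wordSign-++ˡ w (flat ws) v)
    (skew-*ˡ (word-skew (φ zero) w s v) (mono-skew (φ ∘ suc) ws s v))

  -- To regroup by rows, the first word of the second factor moves left past the later rows of the
  -- first factor, which costs a scalar by `mono-skew`.
  mono-* : ∀ {k} (φ : Fin k → Fin n) vs ws →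
           ∃[ a ] (mono φ vs * mono φ ws ≈ a • mono φ (Vec.zipWith _++_ vs ws))
  mono-* φ []       []       = K.1# , refl
  mono-* φ (v ∷ vs) (w ∷ ws) =
    let a , eq = mono-* (φ ∘ suc) vs ws
        s = wordSign (flat vs) w
        i = φ zero
        V = mono (φ ∘ suc) vs
        W = mono (φ ∘ suc) ws
        VW = mono (φ ∘ suc) (Vec.zipWith _++_ vs ws)
    in s K.* a , (begin
      ev i v * V * (ev i w * W)        ≈⟨ trans (*-assoc _ _ _) (*-congˡ (sym (*-assoc _ _ _))) ⟩
      ev i v * (V * ev i w * W)        ≈⟨ *-congˡ (*-congʳ (mono-skew (φ ∘ suc) vs i w)) ⟩
      ev i v * (s • (ev i w * V) * W)  ≈⟨ *-congˡ (trans (*-assoc _ _ _) (*-congˡ (*-assoc _ _ _))) ⟩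
      ev i v * s • (ev i w * (V * W))  ≈⟨ *-•-comm _ _ _ ⟩
      s • (ev i v * (ev i w * (V * W)))    ≈⟨ *-congˡ (sym (*-assoc _ _ _)) ⟩
      s • (ev i v * ev i w * (V * W))      ≈⟨ *-congˡ (*-cong (sym (ev-++ i v w)) eq) ⟩
      s • (ev i (v ++ w) * a • VW)         ≈⟨ *-congˡ (*-•-comm _ _ _) ⟩
      s • a • (ev i (v ++ w) * VW)         ≈⟨ •-assoc s a _ ⟩
      (s K.* a) • (ev i (v ++ w) * VW)     ∎)

  mono-1 : ∀ {k} (φ : Fin k → Fin n) → mono φ (Vec.replicate k []) ≈ const K.1#
  mono-1 {zero}  φ = refl
  mono-1 {suc k} φ = trans (*-identityˡ _) (mono-1 (φ ∘ suc))

  mono-letter : ∀ {k} (φ : Fin k → Fin n) i l →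
                mono φ (Vec.replicate k [] [ i ]≔ (l ∷ [])) ≈ letter (φ i) l
  mono-letter φ zero    l = trans (*-cong (*-identityʳ _) (mono-1 (φ ∘ suc))) (*-identityʳ _)
  mono-letter φ (suc i) l = trans (*-identityˡ _) (mono-letter (φ ∘ suc) i l)

  -- Only linear combinations are built in, because symmetrization is linear but not multiplicative;
  -- closure under products is proved in `Span-*`.
  data Span : Pred Carrier (c ⊔ ℓ) where
    monomials  : ∀ a ws → Span (a • mono id ws)
    sum-closed : ∀ {f g} → Span f → Span g → Span (f + g)
    ≈-closed   : ∀ {f g} → f ≈ g → Span f → Span g

  Span-• : ∀ {f} a → Span f → Span (a • f)
  Span-• a (monomials b ws)   = ≈-closed (sym (•-assoc a b _)) (monomials (a K.* b) ws)
  Span-• a (sum-closed F F′)  = ≈-closed (sym (distribˡ _ _ _)) (sum-closed (Span-• a F) (Span-• a F′))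
  Span-• a (≈-closed f≈g F)   = ≈-closed (*-congˡ f≈g) (Span-• a F)

  Span-* : ∀ {f g} → Span f → Span g → Span (f * g)
  Span-* (sum-closed F F′) H = ≈-closed (sym (distribʳ _ _ _)) (sum-closed (Span-* F H) (Span-* F′ H))
  Span-* (≈-closed f≈g F)  H = ≈-closed (*-congʳ f≈g) (Span-* F H)
  Span-* F@(monomials _ _) (sum-closed H H′) =
    ≈-closed (sym (distribˡ _ _ _)) (sum-closed (Span-* F H) (Span-* F H′))
  Span-* F@(monomials _ _) (≈-closed h≈k H)  = ≈-closed (*-congˡ h≈k) (Span-* F H)
  Span-* (monomials a vs) (monomials b ws) =
    let d , eq = mono-* id vs ws in
    ≈-closed (sym (trans (*-assoc _ _ _) (*-congˡ (trans (*-•-comm _ _ _) (*-congˡ eq)))))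
      (Span-• a (Span-• b (monomials d _)))

  Span-mono : ∀ {f} ws → mono id ws ≈ f → Span f
  Span-mono ws eq = ≈-closed (trans (*-identityˡ _) eq) (monomials K.1# ws)

  spanned : ∀ f → Span f
  spanned (const a) =
    ≈-closed (trans (*-congˡ (mono-1 id)) (*-identityʳ _)) (monomials a (Vec.replicate n []))
  spanned (x r k) = Span-mono _ (mono-letter id r (plain k))
  spanned (θ r j) = Span-mono _ (mono-letter id r (barred j))
  spanned (f + g) = sum-closed (spanned f) (spanned g)
  spanned (f * g) = Span-* (spanned f) (spanned g)
  spanned (- f)   = ≈-closed (sym (-‿as-• f)) (Span-• _ (spanned f))

  -- Sums over all permutations.

  -- A permutation is enumerated by the image `i` of `zero` and a permutation of the rest, in
  -- parallel with the recursion that defines `M`.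
  sumPerm : ∀ k → (Permutation′ k → Carrier) → Carrier
  sumPerm zero    g = g Permutation.id
  sumPerm (suc k) g = sum λ i → sumPerm k λ π → g (Permutation.insert zero i π)

  sumPerm-cong : ∀ k {g h : Permutation′ k → Carrier} → (∀ π → g π ≈ h π) → sumPerm k g ≈ sumPerm k h
  sumPerm-cong zero    g≈h = g≈h Permutation.id
  sumPerm-cong (suc k) g≈h = sum-cong-≋ λ i → sumPerm-cong k λ π → g≈h (Permutation.insert zero i π)

  sumPerm-+ : ∀ k (g h : Permutation′ k → Carrier) →
              sumPerm k (λ π → g π + h π) ≈ sumPerm k g + sumPerm k h
  sumPerm-+ zero    g h = refl
  sumPerm-+ (suc k) g h =
    trans
      (sum-cong-≋ λ i →
        sumPerm-+ k (λ π → g (Permutation.insert zero i π)) (λ π → h (Permutation.insert zero i π)))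
      (∑-distrib-+ (λ i → sumPerm k λ π → g (Permutation.insert zero i π))
                   (λ i → sumPerm k λ π → h (Permutation.insert zero i π)))

  sumPerm-* : ∀ k f (g : Permutation′ k → Carrier) → sumPerm k (λ π → f * g π) ≈ f * sumPerm k g
  sumPerm-* zero    f g = refl
  sumPerm-* (suc k) f g =
    trans (sum-cong-≋ λ i → sumPerm-* k f (λ π → g (Permutation.insert zero i π)))
      (sym (*-distribˡ-sum f (λ i → sumPerm k λ π → g (Permutation.insert zero i π))))

  factorial : ℕ → K.Carrier
  factorial zero    = K.1#
  factorial (suc k) = (suc k ×ᴷ K.1#) K.* factorial k

  sumPerm-constant : ∀ k f → sumPerm k (λ _ → f) ≈ factorial k • f
  sumPerm-constant zero    f = sym (*-identityˡ f)
  sumPerm-constant (suc k) f = begin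
    sum {suc k} (λ _ → sumPerm k (λ _ → f))  ≈⟨ sum-constant (suc k) _ ⟩
    (suc k ×ᴷ K.1#) • sumPerm k (λ _ → f)    ≈⟨ *-congˡ (sumPerm-constant k f) ⟩
    (suc k ×ᴷ K.1#) • factorial k • f        ≈⟨ •-assoc _ _ f ⟩
    factorial (suc k) • f                    ∎

  -- Choosing `k` pairwise distinct indices out of `k` is choosing a permutation. The recursions
  -- agree since `insert zero i π` sends `zero` to `i` and `suc j` to `punchIn i (π ⟨$⟩ʳ j)`.
  sumPerm-mono : ∀ k (φ : Fin k → Fin n) ws →
                 sumPerm k (λ π → mono (φ ∘ (π ⟨$⟩ʳ_)) ws) ≈ M φ ws
  sumPerm-mono zero    φ []       = refl
  sumPerm-mono (suc k) φ (w ∷ ws) = sum-cong-≋ λ i →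
    trans (sumPerm-* k (ev (φ i) w) (λ π → mono (φ ∘ punchIn i ∘ (π ⟨$⟩ʳ_)) ws))
      (*-congˡ (sumPerm-mono k (φ ∘ punchIn i) ws))

  -- The action on monomials, and invariance of the generated elements.

  act-ev : ∀ σ r w → act σ (ev r w) ≡ ev (σ ⟨$⟩ʳ r) w
  act-ev σ r []             = ≡.refl
  act-ev σ r (plain k ∷ w)  = ≡.cong (x (σ ⟨$⟩ʳ r) k *_) (act-ev σ r w)
  act-ev σ r (barred j ∷ w) = ≡.cong (θ (σ ⟨$⟩ʳ r) j *_) (act-ev σ r w)

  act-mono : ∀ {k} σ (φ : Fin k → Fin n) ws → act σ (mono φ ws) ≡ mono ((σ ⟨$⟩ʳ_) ∘ φ) ws
  act-mono σ φ []       = ≡.refl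
  act-mono σ φ (w ∷ ws) = ≡.cong₂ _*_ (act-ev σ (φ zero) w) (act-mono σ (φ ∘ suc) ws)

  act-^ : ∀ σ f e → act σ (f ^ e) ≡ act σ f ^ e
  act-^ σ f zero    = ≡.refl
  act-^ σ f (suc e) = ≡.cong (act σ f *_) (act-^ σ f e)

  act-product : ∀ {N} σ {f g : Fin N → Carrier} → (∀ i → act σ (f i) ≡ g i) →
                act σ (product f) ≡ product g
  act-product {zero}  σ eq = ≡.refl
  act-product {suc N} σ eq = ≡.cong₂ _*_ (eq zero) (act-product σ (eq ∘ suc))

  act-sum : ∀ {N} σ {f g : Fin N → Carrier} → (∀ i → act σ (f i) ≡ g i) → act σ (sum f) ≡ sum g
  act-sum {zero}  σ eq = ≡.refl
  act-sum {suc N} σ eq = ≡.cong₂ _+_ (eq zero) (act-sum σ (eq ∘ suc))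

  act-monomial : ∀ σ r S → act σ (monomial r S) ≡ monomial (σ ⟨$⟩ʳ r) S
  act-monomial σ r S = ≡.cong₂ _*_
    (act-product σ λ k → act-^ σ (x r k) (S (plain k)))
    (act-product σ λ j → act-^ σ (θ r j) (S (barred j)))

  p-invariant : ∀ S → Invariant (p S)
  p-invariant S σ = begin
    act σ (p S)                           ≡⟨ act-sum σ (λ r → act-monomial σ r S) ⟩
    sum (λ r → monomial (σ ⟨$⟩ʳ r) S)     ≈⟨ sum-permute (λ r → monomial r S) σ ⟨
    p S                                   ∎

  G⇒Invariant : ∀ {f} → G f → Invariant f
  G⇒Invariant (generator (S , _ , _ , f≈p)) σ =
    trans (act-cong σ f≈p) (trans (p-invariant S σ) (sym f≈p))
  G⇒Invariant (scalar a)            σ = refl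
  G⇒Invariant (sum-closed F H)      σ = +-cong (G⇒Invariant F σ) (G⇒Invariant H σ)
  G⇒Invariant (product-closed F H)  σ = *-cong (G⇒Invariant F σ) (G⇒Invariant H σ)
  G⇒Invariant (≈-closed f≈h F)      σ =
    trans (act-cong σ (sym f≈h)) (trans (G⇒Invariant F σ) f≈h)

  -- Conclusion when the positive integers are invertible scalars.

  IsUnit : K.Carrier → Set (c ⊔ ℓ)
  IsUnit a = ∃[ b ] (b K.* a K.≈ K.1#)

  IsUnit-* : ∀ {a b} → IsUnit a → IsUnit b → IsUnit (a K.* b)
  IsUnit-* {a} {b} (a⁻¹ , a⁻¹a≈1) (b⁻¹ , b⁻¹b≈1) = b⁻¹ K.* a⁻¹ ,
    K.trans (K.*-assoc _ _ _) (K.trans (K.*-congˡ (K.trans (K.sym (K.*-assoc _ _ _))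
      (K.trans (K.*-congʳ a⁻¹a≈1) (K.*-identityˡ b)))) b⁻¹b≈1)

  IsUnit-‿ : ∀ {a} → IsUnit a → IsUnit (K.- a)
  IsUnit-‿ {a} (a⁻¹ , a⁻¹a≈1) = K.- a⁻¹ ,
    K.trans (K.sym (KP.-‿distribˡ-* a⁻¹ _))
      (K.trans (K.-‿cong (K.sym (KP.-‿distribʳ-* a⁻¹ a)))
        (K.trans (KP.-‿involutive _) a⁻¹a≈1))

  IsUnit-1 : IsUnit K.1#
  IsUnit-1 = K.1# , K.*-identityˡ K.1#

  •-cancel : ∀ {a f} → IsUnit a → G (a • f) → G f
  •-cancel {a} {f} (b , ba≈1) Gaf =
    ≈-closed (trans (•-assoc b a f) (trans (•-congʳ ba≈1) (*-identityˡ f))) (•-closed b Gaf)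

  module _ (isUnit : ∀ k → IsUnit (suc k ×ᴷ K.1#)) where

    leading-isUnit : ∀ l → IsUnit (leading l)
    leading-isUnit zero    = IsUnit-‿ IsUnit-1
    leading-isUnit (suc l) = IsUnit-‿ (IsUnit-* (isUnit l) (leading-isUnit l))

    factorial-isUnit : ∀ k → IsUnit (factorial k)
    factorial-isUnit zero    = IsUnit-1
    factorial-isUnit (suc k) = IsUnit-* (isUnit k) (factorial-isUnit k)

    P∈G : ∀ w → G (P id w)
    P∈G w = <-rec (λ N → ∀ w → length w ≡ N → G (P id w)) step (length w) w ≡.refl
      where
      step : ∀ N → (∀ {N′} → N′ < N → ∀ w → length w ≡ N′ → G (P id w)) →
             ∀ w → length w ≡ N → G (P id w)
      step N rec w |w|≡N with length w ℕ.≤? n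
      ... | yes |w|≤n = P∈G-short w |w|≤n
      ... | no  |w|≰n =
        -- There are `n + 1` words here, so `M id vs` vanishes and `M-leading` leaves a unit
        -- multiple of `P id w`.
        let vs , nonEmpty , vs≡w = split n w (ℕ.≰⇒> |w|≰n)
            M+P∈G = M-leading N (λ v |v|<N → rec |v|<N v ≡.refl) vs nonEmpty
                      (≡.trans (≡.cong length vs≡w) |w|≡N)
        in ≡.subst (λ u → G (P id u)) vs≡w
             (•-cancel (leading-isUnit n)
               (≈-closed (trans (+-congʳ (M-vanishes id vs (ℕ.n<1+n n))) (+-identityˡ _)) M+P∈G))

    symmetrization∈G : ∀ {f} → Span f → G (sumPerm n (λ σ → act σ f))
    symmetrization∈G (monomials a ws) =
      ≈-closed (sym (trans (sumPerm-* n (const a) (λ σ → act σ (mono id ws)))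
                 (*-congˡ (trans (sumPerm-cong n λ σ → Ring.reflexive ring (act-mono σ id ws))
                   (sumPerm-mono n id ws)))))
        -- All power sums already lie in `G`, so any length bound will do; this is the least one
        -- that `M∈G` accepts.
        (•-closed a (M∈G (suc (length (flat ws))) (λ w _ → P∈G w) ws (ℕ.n<1+n _)))
    symmetrization∈G (sum-closed {f} {g} F H) =
      ≈-closed (sym (sumPerm-+ n (λ σ → act σ f) (λ σ → act σ g)))
        (sum-closed (symmetrization∈G F) (symmetrization∈G H))
    symmetrization∈G (≈-closed f≈g F) =
      ≈-closed (sumPerm-cong n λ σ → act-cong σ f≈g) (symmetrization∈G F)

    Invariant⇒G : ∀ {f} → Invariant f → G f
    Invariant⇒G {f} f-invariant = •-cancel (factorial-isUnit n)
      (≈-closed (trans (sumPerm-cong n f-invariant) (sumPerm-constant n f))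
        (symmetrization∈G (spanned f)))

    Invariant≐G : Invariant ≐ G
    Invariant≐G = Invariant⇒G , G⇒Invariant

-- Invertible integers from the rationals, and the case of the complex numbers.

open MonoidMult ℚ.+-0-monoid using () renaming (_×_ to _×ℚ_)

×ℚ-nonNegative : ∀ k → ℚ.NonNegative (k ×ℚ 1ℚ)
×ℚ-nonNegative zero    = _
×ℚ-nonNegative (suc k) = ℚ.nonNeg+nonNeg⇒nonNeg 1ℚ (k ×ℚ 1ℚ) {{×ℚ-nonNegative k}}

module RationalAlgebra {c ℓ} (K : CommutativeRing c ℓ) (h : ℚ → CommutativeRing.Carrier K)
  (h-homomorphism : IsSemiringHomomorphism ℚ.+-*-rawSemiring
                      (Semiring.rawSemiring (CommutativeRing.semiring K)) h) where

  open CommutativeRing K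
  open IsSemiringHomomorphism h-homomorphism
  open MonoidMult +-monoid using () renaming (_×_ to _×ᴷ_)
  open SetoidReasoning setoid

  h-× : ∀ k → h (k ×ℚ 1ℚ) ≈ k ×ᴷ 1#
  h-× zero    = 0#-homo
  h-× (suc k) = trans (+-homo 1ℚ (k ×ℚ 1ℚ)) (+-cong 1#-homo (h-× k))

  -- The inverse is taken among the rationals, where `k + 1` is positive, and carried over by `h`.
  suc×1-isUnit : ∀ k → ∃[ a ] (a * (suc k ×ᴷ 1#) ≈ 1#)
  suc×1-isUnit k = h (ℚ.1/ q) , (begin
    h (ℚ.1/ q) * (suc k ×ᴷ 1#)  ≈⟨ *-congˡ (h-× (suc k)) ⟨
    h (ℚ.1/ q) * h q            ≈⟨ *-homo (ℚ.1/ q) q ⟨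
    h (ℚ.1/ q ℚ.* q)            ≡⟨ ≡.cong h (ℚ.*-inverseˡ q) ⟩
    h 1ℚ                        ≈⟨ 1#-homo ⟩
    1#                          ∎)
    where
    q : ℚ
    q = suc k ×ℚ 1ℚ

    instance
      q-nonZero : ℚ.NonZero q
      q-nonZero = ℚ.pos⇒nonZero q {{ℚ.pos+nonNeg⇒pos 1ℚ (k ×ℚ 1ℚ) {{×ℚ-nonNegative k}}}}

  invariants-generated : ∀ n m m′ → let open SuperPolynomials K n m m′ renaming (_≈_ to _≈ᴾ_) in
    Invariant ≐ GeneratedSubalgebra
      (λ f → ∃[ S ] (NoRepeatedBarred S × size S ≤ n × f ≈ᴾ p S))
  invariants-generated n m m′ = PowerSums.Invariant≐G K n m m′ suc×1-isUnit

open Complexification Real.ℝ-commutativeRing using (_+i_; mk≈)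

rational : ℚ → CommutativeRing.Carrier ℂ
rational q = Real.fromℚ q +i Real.fromℚ 0ℚ

rational-isSemiringHomomorphism :
  IsSemiringHomomorphism ℚ.+-*-rawSemiring (Semiring.rawSemiring (CommutativeRing.semiring ℂ)) rational
rational-isSemiringHomomorphism = record
  { isNearSemiringHomomorphism = record
    { +-isMonoidHomomorphism = record
      { isMagmaHomomorphism = record
        { isRelHomomorphism = record { cong = λ { ≡.refl → CommutativeRing.refl ℂ } }
        ; homo = λ p q → mk≈ (Real.pointwise λ _ → ≡.refl) (Real.pointwise λ _ → ≡.refl)
        }
      ; ε-homo = CommutativeRing.refl ℂ
      }
    ; *-homo = λ p q → mk≈
        -- The contribution of the imaginary parts, the negative of `0ℚ` times `0ℚ`, computes to
        -- `0ℚ`.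
        (Real.pointwise λ _ → ≡.sym (ℚ.+-identityʳ (p ℚ.* q)))
        (Real.pointwise λ _ → ≡.sym (≡.cong₂ ℚ._+_ (ℚ.*-zeroʳ p) (ℚ.*-zeroˡ q)))
    }
  ; 1#-homo = CommutativeRing.refl ℂ
  }

theorem4p3 : ∀ (n m m′ : ℕ) → 1 ≤ n → let open SuperPolynomials ℂ n m m′ in
    Invariant ≐ GeneratedSubalgebra
    (λ f → ∃[ S ] (NoRepeatedBarred S × size S ≤ n × f ≈ p S))
theorem4p3 n m m′ _ = RationalAlgebra.invariants-generated ℂ rational rational-isSemiringHomomorphism n m m′
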